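{- For every composition $\alpha$, the forgetful projection $\pi:\mathrm{NSym}\to\mathrm{Sym}$ satisfies $\pi(S_\alpha^*)=p_\alpha$.
   Context: A composition is a finite sequence $\alpha=(\alpha_1,\dots,\alpha_\ell)$ of positive integers. $\mathrm{QSym}$ is the graded Hopf algebra of quasisymmetric functions with monomial basis $M_\alpha=\sum_{i_1<\cdots<i_\ell}x_{i_1}^{\alpha_1}\cdots x_{i_\ell}^{\alpha_\ell}$, usual product and deconcatenation coproduct $\Delta(M_\alpha)=\sum_{\beta\gamma=\alpha}M_\beta\otimes M_\gamma$. For $\alpha,\beta$ compositions of the same $n$ write $\beta\leq\alpha$ if the set of partial sums $\{\beta_1,\beta_1+\beta_2,\dots\}$ (excluding $n$) is contained in that of $\alpha$. Let $\mathrm{OtE}(\alpha)=\{i:\alpha_i\text{ odd},\alpha_{i+1}\text{ even}\}$; if $\mathrm{OtE}(\alpha)=\{i_1<\cdots<i_k\}$, set $m_o(\alpha)=(\alpha_1+\cdots+\alpha_{i_1},\dots,\alpha_{i_k+1}+\cdots+\alpha_\ell)$. For $\beta$ with $m_o(\alpha)\leq\beta\leq\alpha$, each $\beta_i=\alpha_j+\cdots+\alpha_{j+k}$; let $\mathrm{O}_\alpha^\beta(i)$, $\mathrm{E}_\alpha^\beta(i)$ be the numbers of odd and even entries among $\alpha_j,\dots,\alpha_{j+k}$, and $c_\alpha^\beta=\prod_i \frac{1}{\mathrm{O}_\alpha^\beta(i)!\,\mathrm{E}_\alpha^\beta(i)!}$; the shuffle function is $S_\alpha=\sum_{m_o(\alpha)\leq\beta\leq\alpha}c_\alpha^\beta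 M_\beta$ (these form a basis of $\mathrm{QSym}$). $\mathrm{NSym}$ is the graded dual Hopf algebra of $\mathrm{QSym}$; $\{H_\alpha\}$ is the basis dual to $\{M_\alpha\}$ and $\{S_\alpha^*\}$ the basis dual to $\{S_\alpha\}$. $\mathrm{NSym}$ is freely generated by $H_1,H_2,\dots$ with $H_\alpha=H_{\alpha_1}\cdots H_{\alpha_\ell}$. $\mathrm{Sym}\subseteq\mathrm{QSym}$ is the Hopf algebra of symmetric functions, $h_n=\sum_{\alpha\models n}M_\alpha$, $p_n=\frac1n M_{(n)}$ (scaled power sums), $p_\alpha=p_{\alpha_1}\cdots p_{\alpha_\ell}$. The forgetful projection $\pi:\mathrm{NSym}\to\mathrm{Sym}$ is the algebra morphism with $\pi(H_n)=h_n$. -}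

module Defs where

open import Data.Nat as ℕ using (ℕ; zero; suc; _+_; _∸_; _≡ᵇ_; _!)
open import Data.Nat.Properties using (_!*_!≢0)
open import Data.Bool using (Bool; true; false; _∧_; not; if_then_else_)
open import Data.List using (List; []; _∷_; map; concatMap; filterᵇ; foldr; _++_)
open import Data.Bool.ListAction using (any; all)
open import Data.Nat.ListAction using (sum)
open import Data.List.Relation.Unary.All using (All)
open import Data.List.Properties using (≡-dec)
open import Data.Product using (_×_; _,_; proj₁; proj₂)
open import Data.Integer using (+_)
open import Data.Rational using (ℚ; 0ℚ; 1ℚ; _/_) renaming (_+_ to _+ℚ_; _*_ to _*ℚ_)
open import Relation.Nullary.Decidable using (⌊_⌋)
open import Relation.Binary.PropositionalEquality using (_≡_)

Composition : Set
Composition = List ℕ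

IsComposition : Composition → Set
IsComposition α = All (λ k → 1 ℕ.≤ k) α

_==_ : List ℕ → List ℕ → Bool
α == β = ⌊ ≡-dec ℕ._≟_ α β ⌋

incHead : List ℕ → List ℕ
incHead []       = []
incHead (x ∷ xs) = suc x ∷ xs

compositions : ℕ → List Composition
compositions zero          = [] ∷ []
compositions (suc zero)    = (1 ∷ []) ∷ []
compositions (suc (suc n)) =
  concatMap (λ c → (1 ∷ c) ∷ incHead c ∷ []) (compositions (suc n))

partialSums : Composition → List ℕ
partialSums []           = []
partialSums (a ∷ [])     = []
partialSums (a ∷ b ∷ r)  = a ∷ map (λ s → a + s) (partialSums (b ∷ r))

memb : ℕ → List ℕ → Bool
memb s xs = any (s ≡ᵇ_) xs

-- β ≤ α  iff  partialSums β ⊆ partialSums α  (used for β, α of the same n)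
_≤ᶜ_ : Composition → Composition → Bool
β ≤ᶜ α = all (λ s → memb s (partialSums α)) (partialSums β)

isOdd : ℕ → Bool
isOdd zero    = false
isOdd (suc n) = not (isOdd n)

isEven : ℕ → Bool
isEven n = not (isOdd n)

addHead : ℕ → List ℕ → List ℕ
addHead a []       = a ∷ []
addHead a (x ∷ xs) = (a + x) ∷ xs

moStep : ℕ → List ℕ → List ℕ → List ℕ
moStep a []      rest = a ∷ []
moStep a (b ∷ _) rest = if isOdd a ∧ isEven b then a ∷ rest else addHead a rest

mo : Composition → Composition
mo []      = []
mo (a ∷ r) = moStep a r (mo r)

-- Splitting α into consecutive blocks whose sums are the parts of β (β ≤ α).
takeUpTo : ℕ → List ℕ → List ℕ × List ℕ
takeUpTo zero    xs       = [] , xs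
takeUpTo (suc t) []       = [] , []
takeUpTo (suc t) (x ∷ xs) with takeUpTo (suc t ∸ x) xs
... | (b , r) = (x ∷ b) , r

blocks : Composition → Composition → List (List ℕ)
blocks []       α = []
blocks (b ∷ bs) α = proj₁ (takeUpTo b α) ∷ blocks bs (proj₂ (takeUpTo b α))

countOdd : List ℕ → ℕ
countOdd []       = 0
countOdd (x ∷ xs) = (if isOdd x then 1 else 0) + countOdd xs

countEven : List ℕ → ℕ
countEven []       = 0
countEven (x ∷ xs) = (if isOdd x then 0 else 1) + countEven xs

blockCoeff : List ℕ → ℚ
blockCoeff bl = ((+ 1) / (countOdd bl ! ℕ.* countEven bl !))
  {{countOdd bl !* countEven bl !≢0}}

coeffC : Composition → Composition → ℚ
coeffC α β = foldr (λ bl acc → blockCoeff bl *ℚ acc) 1ℚ (blocks β α)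

-- Finite formal linear combinations (over ℚ) of basis elements indexed
-- by compositions.  Used both for QSym (M-basis) and NSym (H-basis).

LinComb : Set
LinComb = List (ℚ × Composition)

coeff : LinComb → Composition → ℚ
coeff []             γ = 0ℚ
coeff ((a , β) ∷ xs) γ = (if β == γ then a else 0ℚ) +ℚ coeff xs γ

_≈L_ : LinComb → LinComb → Set
x ≈L y = ∀ γ → coeff x γ ≡ coeff y γ

-- Shuffle functions S_α in the M-basis of QSym:
-- S_α = Σ_{m_o(α) ≤ β ≤ α} c_α^β M_β
S : Composition → LinComb
S α = map (λ β → coeffC α β , β)
          (filterᵇ (λ β → mo α ≤ᶜ β ∧ β ≤ᶜ α) (compositions (sum α)))


-- Duality pairing NSym ⊗ QSym → ℚ with ⟨H_β, M_γ⟩ = δ_{β,γ}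
pair : LinComb → LinComb → ℚ
pair x f = foldr (λ t acc → coeff f (proj₂ t) *ℚ proj₁ t +ℚ acc) 0ℚ x

δ : Composition → Composition → ℚ
δ α γ = if α == γ then 1ℚ else 0ℚ

IsDualS : Composition → LinComb → Set
IsDualS α X = All (λ t → IsComposition (proj₂ t)) X
            × (∀ γ → IsComposition γ → pair X (S γ) ≡ δ α γ)

-- Product of QSym in the M-basis (quasi-shuffle product).
qsh : List ℕ → List ℕ → List (List ℕ)
qsh []       ys       = ys ∷ []
qsh (x ∷ xs) []       = (x ∷ xs) ∷ []
qsh (x ∷ xs) (y ∷ ys) =
  map (x ∷_) (qsh xs (y ∷ ys)) ++ map (y ∷_) (qsh (x ∷ xs) ys)
  ++ map (λ zs → (x + y) ∷ zs) (qsh xs ys)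

mulL : LinComb → LinComb → LinComb
mulL f g = concatMap (λ s → concatMap (λ t →
             map (λ γ → (proj₁ s *ℚ proj₁ t , γ)) (qsh (proj₂ s) (proj₂ t))) g) f

oneL : LinComb
oneL = (1ℚ , []) ∷ []

scaleL : ℚ → LinComb → LinComb
scaleL a = map (λ t → (a *ℚ proj₁ t , proj₂ t))

-- h_n = Σ_{γ ⊨ n} M_γ,   h_β = h_{β₁} ⋯ h_{βℓ}
hL : ℕ → LinComb
hL n = map (λ γ → (1ℚ , γ)) (compositions n)

hProd : Composition → LinComb
hProd β = foldr (λ n acc → mulL (hL n) acc) oneL β

-- scaled power sums p_n = (1/n) M_(n),  p_α = p_{α₁} ⋯ p_{αℓ}
pL : ℕ → LinComb
pL zero    = []          -- never used (compositions have positive parts)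
pL (suc k) = ((+ 1) / suc k , suc k ∷ []) ∷ []

pProd : Composition → LinComb
pProd α = foldr (λ n acc → mulL (pL n) acc) oneL α

-- forgetful projection π : NSym → Sym ⊆ QSym, H_β ↦ h_β, extended linearly
π : LinComb → LinComb
π X = concatMap (λ t → scaleL (proj₁ t) (hProd (proj₂ t))) X

{-# OPTIONS --safe #-}
-- The defining expansion of S_γ says dually that H_β = ∑_γ coeff (S γ) β S_γ*, so the theorem
-- amounts to h_β = ∑_γ coeff (S γ) β p_γ: pairing a dual family with the S_γ then isolates p_α.
-- The coefficients are multiplicative over the blocks of β, which reduces this identity to
--   h_n = ∑ p_a / (O(a)! E(a)!)   over the compositions a of n whose even parts precede the odd ones,
-- i.e. to ∑ h_n = exp(∑ p_even) exp(∑ p_odd).  Both sides satisfy Newton's recursion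
-- n h_n = ∑_{k ≥ 1} M_(k) h_{n-k}, which has only one solution.  Quasisymmetric functions are
-- handled through the coefficients of all monomials x^δ, with δ a weak composition, where the
-- quasi-shuffle product becomes convolution.
module Submission where

open import Defs
open import Data.Nat as ℕ using (ℕ; zero; suc; _+_; _∸_; _≡ᵇ_; _!; _≤_; _<_; z≤n; s≤s)
import Data.Nat.Properties as ℕₚ
open import Data.Nat.Induction using (<-rec)
open import Data.Bool using (Bool; true; false; _∧_; _∨_; not; if_then_else_; T)
import Data.Bool.Properties as Boolₚ
open import Data.Empty using (⊥-elim)
open import Data.Integer as ℤ using (+_)
import Data.Integer.Properties as ℤₚ
open import Data.List using (List; []; _∷_; map; concatMap; filterᵇ; _++_; length)
open import Data.List.Relation.Unary.All as All using (All; []; _∷_)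
import Data.List.Relation.Unary.All.Properties as Allₚ
import Data.List.Properties as Listₚ
open import Data.Bool.ListAction using (all)
open import Data.Nat.ListAction using (sum)
open import Data.Product using (Σ; ∃; _×_; _,_; proj₁; proj₂)
open import Data.Rational using (ℚ; 0ℚ; 1ℚ; _/_; toℚᵘ) renaming (_+_ to _+ℚ_; _*_ to _*ℚ_; -_ to -ℚ_)
import Data.Rational.Properties as ℚₚ
open import Data.Rational.Solver using (module +-*-Solver)
open +-*-Solver using (solve; _:=_; _:+_; _:*_; :-_; con)
import Data.Rational.Unnormalised as ℚᵘ
import Data.Rational.Unnormalised.Properties as ℚᵘₚ
open import Data.Sum using (_⊎_; inj₁; inj₂)
open import Function using (_∘_)
open import Relation.Nullary using (yes; no; ¬_; Dec)
open import Relation.Nullary.Decidable using (isYes≗does)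
open import Relation.Binary.PropositionalEquality using (_≡_; _≢_; refl; sym; trans; cong; cong₂; subst; module ≡-Reasoning)
open ≡-Reasoning

-- With coefficients at compositions alone, the merged parts of the quasi-shuffle would enter every
-- computation. Once zeros are allowed in the exponent vector δ, a quasisymmetric function is an
-- ordinary power series in finitely many variables whose coefficients depend only on `nonzeros δ`,
-- and M_(k) acts by lowering one exponent by k. These operators commute, so an exponential of them
-- can be differentiated in the usual way even though the expansion is indexed by ordered
-- compositions. Evens precede odds because m_o(γ) ≤ β says that no block of β contains an odd part
-- directly followed by an even one. The factorials in the coefficients are then those of two
-- exponential series, one for each parity. These series are never formed: each is a family of
-- finite sums that satisfies a recursion in the degree. Two matters remain around this core. A
-- combination of H's may mix degrees, so the sum over all γ is cut off at a degree bound. The dual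
-- family exists because S_γ is unitriangular with respect to the number of parts.

infix 4 _≐_
_≐_ : ∀ {A : Set} → (A → ℚ) → (A → ℚ) → Set
f ≐ g = ∀ x → f x ≡ g x

-- Finite sums

-- Opaque, so that unification can recover the summand from a sum over a concrete list.
opaque

  ∑ : ∀ {A : Set} → List A → (A → ℚ) → ℚ
  ∑ []       F = 0ℚ
  ∑ (x ∷ xs) F = F x +ℚ ∑ xs F

module _ {A : Set} where opaque
  unfolding ∑

  ∑-[] : ∀ (F : A → ℚ) → ∑ [] F ≡ 0ℚ
  ∑-[] F = refl

  ∑-∷ : ∀ x xs (F : A → ℚ) → ∑ (x ∷ xs) F ≡ F x +ℚ ∑ xs F
  ∑-∷ x xs F = refl

  ∑-[-] : ∀ x (F : A → ℚ) → ∑ (x ∷ []) F ≡ F x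
  ∑-[-] x F = ℚₚ.+-identityʳ (F x)

  ∑-cong-All : ∀ {P : A → Set} {xs F G} → All P xs → (∀ {x} → P x → F x ≡ G x) → ∑ xs F ≡ ∑ xs G
  ∑-cong-All []       e = refl
  ∑-cong-All (p ∷ ps) e = cong₂ _+ℚ_ (e p) (∑-cong-All ps e)

  ∑-cong : ∀ (xs : List A) {F G} → F ≐ G → ∑ xs F ≡ ∑ xs G
  ∑-cong []       e = refl
  ∑-cong (x ∷ xs) e = cong₂ _+ℚ_ (e x) (∑-cong xs e)

  ∑-zero : ∀ (xs : List A) {F} → (∀ x → F x ≡ 0ℚ) → ∑ xs F ≡ 0ℚ
  ∑-zero []       e = refl
  ∑-zero (x ∷ xs) e = trans (cong₂ _+ℚ_ (e x) (∑-zero xs e)) (ℚₚ.+-identityˡ 0ℚ)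

  ∑-++ : ∀ (xs ys : List A) F → ∑ (xs ++ ys) F ≡ ∑ xs F +ℚ ∑ ys F
  ∑-++ []       ys F = sym (ℚₚ.+-identityˡ (∑ ys F))
  ∑-++ (x ∷ xs) ys F = trans (cong (F x +ℚ_) (∑-++ xs ys F)) (sym (ℚₚ.+-assoc (F x) (∑ xs F) (∑ ys F)))

  ∑-+ : ∀ (xs : List A) F G → ∑ xs (λ x → F x +ℚ G x) ≡ ∑ xs F +ℚ ∑ xs G
  ∑-+ []       F G = refl
  ∑-+ (x ∷ xs) F G = trans (cong ((F x +ℚ G x) +ℚ_) (∑-+ xs F G))
    (solve 4 (λ a b c d → (a :+ b) :+ (c :+ d) := (a :+ c) :+ (b :+ d)) refl (F x) (G x) (∑ xs F) (∑ xs G))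

  ∑-*ˡ : ∀ (xs : List A) c F → ∑ xs (λ x → c *ℚ F x) ≡ c *ℚ ∑ xs F
  ∑-*ˡ []       c F = sym (ℚₚ.*-zeroʳ c)
  ∑-*ˡ (x ∷ xs) c F = trans (cong (c *ℚ F x +ℚ_) (∑-*ˡ xs c F)) (sym (ℚₚ.*-distribˡ-+ c (F x) (∑ xs F)))

  ∑-*ʳ : ∀ (xs : List A) c F → ∑ xs (λ x → F x *ℚ c) ≡ ∑ xs F *ℚ c
  ∑-*ʳ xs c F = trans (∑-cong xs (λ x → ℚₚ.*-comm (F x) c)) (trans (∑-*ˡ xs c F) (ℚₚ.*-comm c (∑ xs F)))

module _ {A B : Set} where opaque
  unfolding ∑

  ∑-map : ∀ (g : A → B) xs F → ∑ (map g xs) F ≡ ∑ xs (λ x → F (g x))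
  ∑-map g []       F = refl
  ∑-map g (x ∷ xs) F = cong (F (g x) +ℚ_) (∑-map g xs F)

  ∑-concatMap : ∀ (g : A → List B) xs F → ∑ (concatMap g xs) F ≡ ∑ xs (λ x → ∑ (g x) F)
  ∑-concatMap g []       F = refl
  ∑-concatMap g (x ∷ xs) F = trans (∑-++ (g x) (concatMap g xs) F) (cong (∑ (g x) F +ℚ_) (∑-concatMap g xs F))

  ∑-swap : ∀ (xs : List A) (ys : List B) (F : A → B → ℚ) → ∑ xs (λ x → ∑ ys (F x)) ≡ ∑ ys (λ y → ∑ xs (λ x → F x y))
  ∑-swap []       ys F = sym (∑-zero ys (λ _ → refl))
  ∑-swap (x ∷ xs) ys F = trans (cong (∑ ys (F x) +ℚ_) (∑-swap xs ys F)) (sym (∑-+ ys (F x) (λ y → ∑ xs (λ x → F x y))))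

-- Rational constants

⟦_⟧ : Bool → ℚ
⟦ b ⟧ = if b then 1ℚ else 0ℚ

⟦∧⟧ : ∀ a b → ⟦ a ∧ b ⟧ ≡ ⟦ a ⟧ *ℚ ⟦ b ⟧
⟦∧⟧ true  b = sym (ℚₚ.*-identityˡ _)
⟦∧⟧ false b = sym (ℚₚ.*-zeroˡ ⟦ b ⟧)

-- Defined by recursion so that `ι (suc n)` is `1ℚ +ℚ ι n` by computation and can be given to the
-- ring solver in that form; `ι≡/1` relates it to fractions.
ι : ℕ → ℚ
ι zero    = 0ℚ
ι (suc n) = 1ℚ +ℚ ι n

ι-+ : ∀ m n → ι (m + n) ≡ ι m +ℚ ι n
ι-+ zero    n = sym (ℚₚ.+-identityˡ _)
ι-+ (suc m) n = trans (cong (1ℚ +ℚ_) (ι-+ m n)) (sym (ℚₚ.+-assoc 1ℚ (ι m) (ι n)))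

ι-* : ∀ m n → ι (m ℕ.* n) ≡ ι m *ℚ ι n
ι-* zero    n = sym (ℚₚ.*-zeroˡ (ι n))
ι-* (suc m) n = trans (ι-+ n (m ℕ.* n)) (trans (cong (ι n +ℚ_) (ι-* m n))
  (solve 2 (λ a b → b :+ a :* b := (con 1ℚ :+ a) :* b) refl (ι m) (ι n)))

ι≡/1 : ∀ n → toℚᵘ (ι n) ℚᵘ.≃ (+ n ℚᵘ./ 1)
ι≡/1 zero    = ℚᵘ.*≡* refl
ι≡/1 (suc n) = ℚᵘₚ.≃-trans (ℚₚ.toℚᵘ-homo-+ 1ℚ (ι n))
  (ℚᵘₚ.≃-trans (ℚᵘₚ.+-congʳ (toℚᵘ 1ℚ) (ι≡/1 n))
    (ℚᵘ.*≡* (cong (λ z → (+ 1 ℤ.+ z) ℤ.* + 1) (ℤₚ.*-identityʳ (+ n)))))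

ι*1/ : ∀ n .{{_ : ℕ.NonZero n}} → ι n *ℚ (+ 1 / n) ≡ 1ℚ
ι*1/ n@(suc k) = ℚₚ.toℚᵘ-injective (ℚᵘₚ.≃-trans (ℚₚ.toℚᵘ-homo-* (ι n) (+ 1 / n))
  (ℚᵘₚ.≃-trans (ℚᵘₚ.*-cong (ι≡/1 n) (ℚₚ.toℚᵘ-fromℚᵘ (ℚᵘ.mkℚᵘ (+ 1) k)))
    (ℚᵘ.*≡* (cong (+_ ∘ suc) (trans (trans (ℕₚ.*-identityʳ _) (ℕₚ.*-identityʳ k))
      (sym (trans (ℕₚ.+-identityʳ _) (ℕₚ.+-identityʳ k))))))))

-- Reciprocals of factorials are compared after multiplication by a common denominator, which avoids
-- normalising fractions.
inverse-unique : ∀ x {a b} → x *ℚ a ≡ 1ℚ → x *ℚ b ≡ 1ℚ → a ≡ b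
inverse-unique x {a} {b} p q = begin
  a              ≡⟨ ℚₚ.*-identityʳ a ⟨
  a *ℚ 1ℚ        ≡⟨ cong (a *ℚ_) q ⟨
  a *ℚ (x *ℚ b)  ≡⟨ solve 3 (λ a b x → a :* (x :* b) := (x :* a) :* b) refl a b x ⟩
  (x *ℚ a) *ℚ b  ≡⟨ cong (_*ℚ b) p ⟩
  1ℚ *ℚ b        ≡⟨ ℚₚ.*-identityˡ b ⟩
  b              ∎

-- The value at 0 is junk; it makes the weights of 𝒯 below vanish at 0.
inv : ℕ → ℚ
inv zero    = 0ℚ
inv (suc k) = + 1 / suc k

ι-cancel : ∀ n {a b} → ι (suc n) *ℚ a ≡ ι (suc n) *ℚ b → a ≡ b
ι-cancel n {a} {b} e = begin
  a                                 ≡⟨ lem a ⟨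
  inv (suc n) *ℚ (ι (suc n) *ℚ a)   ≡⟨ cong (inv (suc n) *ℚ_) e ⟩
  inv (suc n) *ℚ (ι (suc n) *ℚ b)   ≡⟨ lem b ⟩
  b                                 ∎
  where
  lem : ∀ x → inv (suc n) *ℚ (ι (suc n) *ℚ x) ≡ x
  lem x = begin
    inv (suc n) *ℚ (ι (suc n) *ℚ x) ≡⟨ solve 3 (λ i k x → i :* (k :* x) := (k :* i) :* x) refl (inv (suc n)) (ι (suc n)) x ⟩
    (ι (suc n) *ℚ inv (suc n)) *ℚ x ≡⟨ cong (_*ℚ x) (ι*1/ (suc n)) ⟩
    1ℚ *ℚ x                         ≡⟨ ℚₚ.*-identityˡ x ⟩
    x                               ∎

1/! : ℕ → ℚ
1/! n = (+ 1 / n !) {{n ℕₚ.!≢0}}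

ι*1/! : ∀ n → ι (suc n) *ℚ 1/! (suc n) ≡ 1/! n
ι*1/! n = inverse-unique (ι (n !)) (begin
  ι (n !) *ℚ (ι (suc n) *ℚ 1/! (suc n)) ≡⟨ solve 3 (λ a b c → a :* (b :* c) := (b :* a) :* c) refl (ι (n !)) (ι (suc n)) (1/! (suc n)) ⟩
  (ι (suc n) *ℚ ι (n !)) *ℚ 1/! (suc n) ≡⟨ cong (_*ℚ 1/! (suc n)) (ι-* (suc n) (n !)) ⟨
  ι (suc n !) *ℚ 1/! (suc n)            ≡⟨ ι*1/ (suc n !) {{suc n ℕₚ.!≢0}} ⟩
  1ℚ                                    ∎)
  (ι*1/ (n !) {{n ℕₚ.!≢0}})

blockCoeff-1/! : ∀ a → blockCoeff a ≡ 1/! (countOdd a) *ℚ 1/! (countEven a)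
blockCoeff-1/! a = inverse-unique (ι (o ! ℕ.* e !)) (ι*1/ (o ! ℕ.* e !) {{o ℕₚ.!* e !≢0}}) (begin
  ι (o ! ℕ.* e !) *ℚ (1/! o *ℚ 1/! e)           ≡⟨ cong (_*ℚ (1/! o *ℚ 1/! e)) (ι-* (o !) (e !)) ⟩
  (ι (o !) *ℚ ι (e !)) *ℚ (1/! o *ℚ 1/! e)      ≡⟨ solve 4 (λ a b c d → (a :* b) :* (c :* d) := (a :* c) :* (b :* d)) refl (ι (o !)) (ι (e !)) (1/! o) (1/! e) ⟩
  (ι (o !) *ℚ 1/! o) *ℚ (ι (e !) *ℚ 1/! e)      ≡⟨ cong₂ _*ℚ_ (ι*1/ (o !) {{o ℕₚ.!≢0}}) (ι*1/ (e !) {{e ℕₚ.!≢0}}) ⟩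
  1ℚ                                            ∎)
  where
  o = countOdd a
  e = countEven a

-- Splittings of numbers and weak compositions

splits : ℕ → List (ℕ × ℕ)
splits zero    = (0 , 0) ∷ []
splits (suc n) = (0 , suc n) ∷ map (λ p → suc (proj₁ p) , proj₂ p) (splits n)

∑-splits-suc : ∀ n (F : ℕ × ℕ → ℚ) → ∑ (splits (suc n)) F ≡ F (0 , suc n) +ℚ ∑ (splits n) (λ p → F (suc (proj₁ p) , proj₂ p))
∑-splits-suc n F = trans (∑-∷ _ _ F) (cong (F (0 , suc n) +ℚ_) (∑-map _ (splits n) F))

splits-sum : ∀ n → All (λ p → proj₁ p + proj₂ p ≡ n) (splits n)
splits-sum zero    = refl ∷ []
splits-sum (suc n) = refl ∷ Allₚ.map⁺ (All.map (cong suc) (splits-sum n))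

-- Both sides run over the ordered triples of total `n`.
∑-splits-assoc : ∀ n (F : ℕ → ℕ → ℕ → ℚ) →
  ∑ (splits n) (λ p → ∑ (splits (proj₂ p)) (λ q → F (proj₁ p) (proj₁ q) (proj₂ q)))
  ≡ ∑ (splits n) (λ p → ∑ (splits (proj₁ p)) (λ q → F (proj₁ q) (proj₂ q) (proj₂ p)))
∑-splits-assoc zero    F = trans (trans (∑-[-] _ _) (∑-[-] _ _)) (sym (trans (∑-[-] _ _) (∑-[-] _ _)))
∑-splits-assoc (suc n) F = begin
  ∑ (splits (suc n)) (λ p → ∑ (splits (proj₂ p)) (λ q → F (proj₁ p) (proj₁ q) (proj₂ q)))
    ≡⟨ ∑-splits-suc n _ ⟩
  ∑ (splits (suc n)) (λ q → F 0 (proj₁ q) (proj₂ q)) +ℚ ∑ (splits n) (λ p → ∑ (splits (proj₂ p)) (λ q → F (suc (proj₁ p)) (proj₁ q) (proj₂ q)))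
    ≡⟨ cong₂ _+ℚ_ (∑-splits-suc n _) (∑-splits-assoc n (λ k → F (suc k))) ⟩
  (F 0 0 (suc n) +ℚ ∑ (splits n) (λ p → F 0 (suc (proj₁ p)) (proj₂ p))) +ℚ ∑ (splits n) (λ p → ∑ (splits (proj₁ p)) (λ q → F (suc (proj₁ q)) (proj₂ q) (proj₂ p)))
    ≡⟨ trans (ℚₚ.+-assoc (F 0 0 (suc n)) (∑ (splits n) _) (∑ (splits n) _)) (cong (_+ℚ (∑ (splits n) _ +ℚ ∑ (splits n) _)) (sym (∑-[-] (0 , 0) (λ q → F (proj₁ q) (proj₂ q) (suc n))))) ⟩
  ∑ (splits 0) (λ q → F (proj₁ q) (proj₂ q) (suc n)) +ℚ (∑ (splits n) (λ p → F 0 (suc (proj₁ p)) (proj₂ p)) +ℚ ∑ (splits n) (λ p → ∑ (splits (proj₁ p)) (λ q → F (suc (proj₁ q)) (proj₂ q) (proj₂ p))))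
    ≡⟨ cong (∑ (splits 0) (λ q → F (proj₁ q) (proj₂ q) (suc n)) +ℚ_) (∑-+ (splits n) _ _) ⟨
  ∑ (splits 0) (λ q → F (proj₁ q) (proj₂ q) (suc n)) +ℚ ∑ (splits n) (λ p → F 0 (suc (proj₁ p)) (proj₂ p) +ℚ ∑ (splits (proj₁ p)) (λ q → F (suc (proj₁ q)) (proj₂ q) (proj₂ p)))
    ≡⟨ cong (∑ (splits 0) (λ q → F (proj₁ q) (proj₂ q) (suc n)) +ℚ_) (∑-cong (splits n) (λ p → sym (∑-splits-suc (proj₁ p) _))) ⟩
  ∑ (splits 0) (λ q → F (proj₁ q) (proj₂ q) (suc n)) +ℚ ∑ (splits n) (λ p → ∑ (splits (suc (proj₁ p))) (λ q → F (proj₁ q) (proj₂ q) (proj₂ p)))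
    ≡⟨ ∑-splits-suc n _ ⟨
  ∑ (splits (suc n)) (λ p → ∑ (splits (proj₁ p)) (λ q → F (proj₁ q) (proj₂ q) (proj₂ p))) ∎

-- `splits` can be peeled only at its first pair. The last pair is reached through the induction
-- hypothesis at `suc n`, and what lies between needs the one at `n`, whence the two base cases.
∑-splits-comm : ∀ n (F : ℕ → ℕ → ℚ) → ∑ (splits n) (λ p → F (proj₁ p) (proj₂ p)) ≡ ∑ (splits n) (λ p → F (proj₂ p) (proj₁ p))
∑-splits-comm zero          F = trans (∑-[-] _ _) (sym (∑-[-] _ _))
∑-splits-comm (suc zero)    F = begin
  ∑ (splits 1) (λ p → F (proj₁ p) (proj₂ p)) ≡⟨ trans (∑-∷ _ _ _) (cong (F 0 1 +ℚ_) (∑-[-] _ _)) ⟩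
  F 0 1 +ℚ F 1 0                             ≡⟨ ℚₚ.+-comm (F 0 1) (F 1 0) ⟩
  F 1 0 +ℚ F 0 1                             ≡⟨ trans (∑-∷ _ _ _) (cong (F 1 0 +ℚ_) (∑-[-] _ _)) ⟨
  ∑ (splits 1) (λ p → F (proj₂ p) (proj₁ p)) ∎
∑-splits-comm (suc (suc n)) F = begin
  ∑ (splits (suc (suc n))) (λ p → F (proj₁ p) (proj₂ p))
    ≡⟨ trans (∑-splits-suc (suc n) _) (cong (F 0 (suc (suc n)) +ℚ_) (∑-splits-comm (suc n) (λ i → F (suc i)))) ⟩
  F 0 (suc (suc n)) +ℚ ∑ (splits (suc n)) (λ p → F (suc (proj₂ p)) (proj₁ p))
    ≡⟨ cong (F 0 (suc (suc n)) +ℚ_) (∑-splits-suc n _) ⟩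
  F 0 (suc (suc n)) +ℚ (F (suc (suc n)) 0 +ℚ ∑ (splits n) (λ p → F (suc (proj₂ p)) (suc (proj₁ p))))
    ≡⟨ cong (λ z → F 0 (suc (suc n)) +ℚ (F (suc (suc n)) 0 +ℚ z)) (∑-splits-comm n (λ i j → F (suc j) (suc i))) ⟩
  F 0 (suc (suc n)) +ℚ (F (suc (suc n)) 0 +ℚ ∑ (splits n) (λ p → F (suc (proj₁ p)) (suc (proj₂ p))))
    ≡⟨ solve 3 (λ a b c → a :+ (b :+ c) := b :+ (a :+ c)) refl (F 0 (suc (suc n))) (F (suc (suc n)) 0) (∑ (splits n) _) ⟩
  F (suc (suc n)) 0 +ℚ (F 0 (suc (suc n)) +ℚ ∑ (splits n) (λ p → F (suc (proj₁ p)) (suc (proj₂ p))))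
    ≡⟨ cong (F (suc (suc n)) 0 +ℚ_) (∑-splits-suc n _) ⟨
  F (suc (suc n)) 0 +ℚ ∑ (splits (suc n)) (λ p → F (proj₁ p) (suc (proj₂ p)))
    ≡⟨ cong (F (suc (suc n)) 0 +ℚ_) (∑-splits-comm (suc n) (λ i j → F i (suc j))) ⟩
  F (suc (suc n)) 0 +ℚ ∑ (splits (suc n)) (λ p → F (proj₂ p) (suc (proj₁ p)))
    ≡⟨ ∑-splits-suc (suc n) _ ⟨
  ∑ (splits (suc (suc n))) (λ p → F (proj₂ p) (proj₁ p)) ∎

∑-splits-exchange : ∀ n (F : ℕ → ℕ → ℕ → ℚ) →
  ∑ (splits n) (λ p → ∑ (splits (proj₂ p)) (λ q → F (proj₁ p) (proj₁ q) (proj₂ q)))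
  ≡ ∑ (splits n) (λ p → ∑ (splits (proj₂ p)) (λ q → F (proj₁ q) (proj₁ p) (proj₂ q)))
∑-splits-exchange n F = begin
  _ ≡⟨ ∑-splits-assoc n F ⟩
  _ ≡⟨ ∑-cong (splits n) (λ p → ∑-splits-comm (proj₁ p) (λ i j → F i j (proj₂ p))) ⟩
  _ ≡⟨ ∑-splits-assoc n (λ i j → F j i) ⟨
  _ ∎

-- Subtraction as a list with at most one entry: when x^k does not divide x^d the sum over it is
-- empty, so no side condition is carried along.
sub : ℕ → ℕ → List ℕ
sub zero    d       = d ∷ []
sub (suc k) zero    = []
sub (suc k) (suc d) = sub k d

-- The quotients of x^δ by the k-th power of a single variable, which index the terms of M_(k) g at
-- x^δ. For `k = 0` this is one copy of δ per entry rather than a single one; the weights used below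
-- vanish there.
lower : ℕ → List ℕ → List (List ℕ)
lower k []      = []
lower k (d ∷ δ) = map (_∷ δ) (sub k d) ++ map (d ∷_) (lower k δ)

∑-lower-∷ : ∀ k d δ F → ∑ (lower k (d ∷ δ)) F ≡ ∑ (sub k d) (λ j → F (j ∷ δ)) +ℚ ∑ (lower k δ) (λ ε → F (d ∷ ε))
∑-lower-∷ k d δ F = trans (∑-++ (map (_∷ δ) (sub k d)) _ F) (cong₂ _+ℚ_ (∑-map _ (sub k d) F) (∑-map _ (lower k δ) F))

decomps : List ℕ → List (List ℕ × List ℕ)
decomps []      = ([] , []) ∷ []
decomps (d ∷ δ) = concatMap (λ p → map (λ q → proj₁ p ∷ proj₁ q , proj₂ p ∷ proj₂ q) (decomps δ)) (splits d)

∑-decomps-∷ : ∀ d δ F → ∑ (decomps (d ∷ δ)) F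
  ≡ ∑ (splits d) (λ p → ∑ (decomps δ) (λ q → F (proj₁ p ∷ proj₁ q , proj₂ p ∷ proj₂ q)))
∑-decomps-∷ d δ F = trans (∑-concatMap _ (splits d) F) (∑-cong (splits d) (λ p → ∑-map _ (decomps δ) F))

∑-sub-pick : ∀ k d (G : ℕ → ℚ) → ∑ (splits d) (λ p → ⟦ k ≡ᵇ proj₁ p ⟧ *ℚ G (proj₂ p)) ≡ ∑ (sub k d) G
∑-sub-pick zero    zero    G = trans (∑-[-] _ _) (trans (ℚₚ.*-identityˡ (G 0)) (sym (∑-[-] _ G)))
∑-sub-pick (suc k) zero    G = trans (∑-[-] _ _) (trans (ℚₚ.*-zeroˡ (G 0)) (sym (∑-[] G)))
∑-sub-pick zero    (suc d) G = trans (∑-splits-suc d _)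
  (trans (cong₂ _+ℚ_ (ℚₚ.*-identityˡ (G (suc d))) (∑-zero (splits d) (λ p → ℚₚ.*-zeroˡ (G (proj₂ p)))))
    (trans (ℚₚ.+-identityʳ (G (suc d))) (sym (∑-[-] _ G))))
∑-sub-pick (suc k) (suc d) G = trans (∑-splits-suc d _)
  (trans (cong₂ _+ℚ_ (ℚₚ.*-zeroˡ (G (suc d))) (∑-sub-pick k d G)) (ℚₚ.+-identityˡ (∑ (sub k d) G)))

-- Coefficients and the quasi-shuffle product

==-∷ : ∀ x xs y ys → ((x ∷ xs) == (y ∷ ys)) ≡ (x ≡ᵇ y) ∧ (xs == ys)
==-∷ x xs y ys = trans (isYes≗does (Listₚ.≡-dec ℕ._≟_ (x ∷ xs) (y ∷ ys)))
  (cong ((x ≡ᵇ y) ∧_) (sym (isYes≗does (Listₚ.≡-dec ℕ._≟_ xs ys))))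

⟦==-∷⟧ : ∀ x xs y ys → ⟦ (x ∷ xs) == (y ∷ ys) ⟧ ≡ ⟦ x ≡ᵇ y ⟧ *ℚ ⟦ xs == ys ⟧
⟦==-∷⟧ x xs y ys = trans (cong ⟦_⟧ (==-∷ x xs y ys)) (⟦∧⟧ (x ≡ᵇ y) (xs == ys))

==-refl : ∀ xs → (xs == xs) ≡ true
==-refl xs with Listₚ.≡-dec ℕ._≟_ xs xs
... | yes _ = refl
... | no  n = ⊥-elim (n refl)

==-≢ : ∀ {xs ys} → xs ≢ ys → (xs == ys) ≡ false
==-≢ {xs} {ys} n with Listₚ.≡-dec ℕ._≟_ xs ys
... | yes e = ⊥-elim (n e)
... | no  _ = refl

≡ᵇ-comm : ∀ m n → (m ≡ᵇ n) ≡ (n ≡ᵇ m)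
≡ᵇ-comm zero    zero    = refl
≡ᵇ-comm zero    (suc n) = refl
≡ᵇ-comm (suc m) zero    = refl
≡ᵇ-comm (suc m) (suc n) = ≡ᵇ-comm m n

≡ᵇ-cancelˡ : ∀ k m n → (k + m ≡ᵇ k + n) ≡ (m ≡ᵇ n)
≡ᵇ-cancelˡ zero    m n = refl
≡ᵇ-cancelˡ (suc k) m n = ≡ᵇ-cancelˡ k m n

coeff-∑ : ∀ g γ → coeff g γ ≡ ∑ g (λ t → proj₁ t *ℚ ⟦ proj₂ t == γ ⟧)
coeff-∑ []            γ = sym (∑-[] _)
coeff-∑ ((a , β) ∷ g) γ = trans (cong₂ _+ℚ_ (lem (β == γ)) (coeff-∑ g γ)) (sym (∑-∷ _ g _))
  where
  lem : ∀ b → (if b then a else 0ℚ) ≡ a *ℚ ⟦ b ⟧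
  lem true  = sym (ℚₚ.*-identityʳ a)
  lem false = sym (ℚₚ.*-zeroʳ a)

nonzeros : List ℕ → List ℕ
nonzeros []          = []
nonzeros (zero  ∷ δ) = nonzeros δ
nonzeros (suc d ∷ δ) = suc d ∷ nonzeros δ

nonzeros-positive : ∀ δ → IsComposition (nonzeros δ)
nonzeros-positive []          = []
nonzeros-positive (zero  ∷ δ) = nonzeros-positive δ
nonzeros-positive (suc d ∷ δ) = s≤s z≤n ∷ nonzeros-positive δ

nonzeros-id : ∀ {δ} → IsComposition δ → nonzeros δ ≡ δ
nonzeros-id []             = refl
nonzeros-id (s≤s z≤n ∷ ps) = cong (_ ∷_) (nonzeros-id ps)

sum-nonzeros : ∀ δ → sum (nonzeros δ) ≡ sum δ
sum-nonzeros []          = refl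
sum-nonzeros (zero  ∷ δ) = sum-nonzeros δ
sum-nonzeros (suc d ∷ δ) = cong (λ s → suc d + s) (sum-nonzeros δ)

-- The coefficient of the monomial x^δ of the power series M_β, for a weak composition δ.
mono : List ℕ → List ℕ → ℚ
mono β δ = ⟦ β == nonzeros δ ⟧

mono-∷-suc : ∀ b β d δ → mono (b ∷ β) (suc d ∷ δ) ≡ ⟦ b ≡ᵇ suc d ⟧ *ℚ mono β δ
mono-∷-suc b β d δ = ⟦==-∷⟧ b β (suc d) (nonzeros δ)

val : LinComb → List ℕ → ℚ
val g δ = coeff g (nonzeros δ)

val-∑ : ∀ g δ → val g δ ≡ ∑ g (λ t → proj₁ t *ℚ mono (proj₂ t) δ)
val-∑ g δ = coeff-∑ g (nonzeros δ)

count : List (List ℕ) → List ℕ → ℚ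
count cs δ = ∑ cs (λ c → mono c δ)

count-map-∷ : ∀ x cs d δ → count (map (x ∷_) cs) (suc d ∷ δ) ≡ ⟦ x ≡ᵇ suc d ⟧ *ℚ count cs δ
count-map-∷ x cs d δ = trans (∑-map _ cs _) (trans (∑-cong cs (λ c → mono-∷-suc x c d δ)) (∑-*ˡ cs ⟦ x ≡ᵇ suc d ⟧ _))

count-map-∷-[] : ∀ x cs → count (map (x ∷_) cs) [] ≡ 0ℚ
count-map-∷-[] x cs = trans (∑-map _ cs _) (∑-zero cs (λ _ → refl))

convolution : (List ℕ → ℚ) → (List ℕ → ℚ) → List ℕ → ℚ
convolution f g δ = ∑ (decomps δ) (λ q → f (proj₁ q) *ℚ g (proj₂ q))

-- What is left of an exponent after removing the part `suc p` is either nothing or exactly the part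
-- `suc q`. The second alternative is where the merged part of a quasi-shuffle comes from. Here `p`
-- and `d` are predecessors of the actual part and exponent.
∑-sub-two : ∀ p q d (G : ℕ → ℚ) x y → G 0 ≡ x → (∀ j → G (suc j) ≡ ⟦ q ≡ᵇ j ⟧ *ℚ y) →
  ∑ (sub p d) G ≡ ⟦ p ≡ᵇ d ⟧ *ℚ x +ℚ ⟦ p + suc q ≡ᵇ d ⟧ *ℚ y
∑-sub-two zero    q zero    G x y e f = trans (∑-[-] _ G) (trans e (solve 2 (λ x y → x := con 1ℚ :* x :+ con 0ℚ :* y) refl x y))
∑-sub-two zero    q (suc d) G x y e f = trans (∑-[-] _ G) (trans (f d) (solve 3 (λ x y z → z :* y := con 0ℚ :* x :+ z :* y) refl x y ⟦ q ≡ᵇ d ⟧))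
∑-sub-two (suc p) q zero    G x y e f = trans (∑-[] G) (solve 2 (λ x y → con 0ℚ := con 0ℚ :* x :+ con 0ℚ :* y) refl x y)
∑-sub-two (suc p) q (suc d) G x y e f = ∑-sub-two p q d G x y e f

convolution-mono-[] : ∀ g d δ → convolution (mono []) g (suc d ∷ δ) ≡ convolution (mono []) (λ v → g (suc d ∷ v)) δ
convolution-mono-[] g d δ = begin
  convolution (mono []) g (suc d ∷ δ)
    ≡⟨ trans (∑-decomps-∷ (suc d) δ _) (∑-splits-suc d _) ⟩
  convolution (mono []) (λ v → g (suc d ∷ v)) δ +ℚ _
    ≡⟨ cong (convolution (mono []) (λ v → g (suc d ∷ v)) δ +ℚ_)
         (∑-zero (splits d) (λ p → ∑-zero (decomps δ) (λ q → ℚₚ.*-zeroˡ (g (proj₂ p ∷ proj₂ q))))) ⟩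
  convolution (mono []) (λ v → g (suc d ∷ v)) δ +ℚ 0ℚ
    ≡⟨ ℚₚ.+-identityʳ (convolution (mono []) (λ v → g (suc d ∷ v)) δ) ⟩
  convolution (mono []) (λ v → g (suc d ∷ v)) δ ∎

-- In the left factor the first variable is either absent or carries exactly the first part `suc p`.
convolution-mono-∷ : ∀ p a g d δ → convolution (mono (suc p ∷ a)) g (suc d ∷ δ)
  ≡ convolution (mono (suc p ∷ a)) (λ v → g (suc d ∷ v)) δ +ℚ ∑ (sub p d) (λ j → convolution (mono a) (λ v → g (j ∷ v)) δ)
convolution-mono-∷ p a g d δ = begin
  convolution (mono (suc p ∷ a)) g (suc d ∷ δ)
    ≡⟨ trans (∑-decomps-∷ (suc d) δ _) (∑-splits-suc d _) ⟩
  c +ℚ ∑ (splits d) (λ s → ∑ (decomps δ) (λ q → mono (suc p ∷ a) (suc (proj₁ s) ∷ proj₁ q) *ℚ g (proj₂ s ∷ proj₂ q)))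
    ≡⟨ cong (c +ℚ_) (∑-cong (splits d) (λ s → trans
         (∑-cong (decomps δ) (λ q → trans (cong (_*ℚ g (proj₂ s ∷ proj₂ q)) (mono-∷-suc (suc p) a (proj₁ s) (proj₁ q)))
           (ℚₚ.*-assoc ⟦ p ≡ᵇ proj₁ s ⟧ (mono a (proj₁ q)) (g (proj₂ s ∷ proj₂ q)))))
         (∑-*ˡ (decomps δ) ⟦ p ≡ᵇ proj₁ s ⟧ _))) ⟩
  c +ℚ ∑ (splits d) (λ s → ⟦ p ≡ᵇ proj₁ s ⟧ *ℚ convolution (mono a) (λ v → g (proj₂ s ∷ v)) δ)
    ≡⟨ cong (c +ℚ_) (∑-sub-pick p d (λ j → convolution (mono a) (λ v → g (j ∷ v)) δ)) ⟩
  c +ℚ ∑ (sub p d) (λ j → convolution (mono a) (λ v → g (j ∷ v)) δ) ∎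
  where c = convolution (mono (suc p ∷ a)) (λ v → g (suc d ∷ v)) δ

convolution-zeroʳ : ∀ f δ → convolution f (λ _ → 0ℚ) δ ≡ 0ℚ
convolution-zeroʳ f δ = ∑-zero (decomps δ) (λ q → ℚₚ.*-zeroʳ (f (proj₁ q)))

convolutionʳ-mono-∷ : ∀ f b β d δ → convolution f (λ v → mono (b ∷ β) (suc d ∷ v)) δ ≡ ⟦ b ≡ᵇ suc d ⟧ *ℚ convolution f (mono β) δ
convolutionʳ-mono-∷ f b β d δ = trans
  (∑-cong (decomps δ) (λ q → trans (cong (f (proj₁ q) *ℚ_) (mono-∷-suc b β d (proj₂ q)))
    (solve 3 (λ x y z → x :* (y :* z) := y :* (x :* z)) refl (f (proj₁ q)) ⟦ b ≡ᵇ suc d ⟧ (mono β (proj₂ q)))))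
  (∑-*ˡ (decomps δ) ⟦ b ≡ᵇ suc d ⟧ _)

-- Each part of δ in a term of the quasi-shuffle of a and b comes from a, from b, or from both.
count-qsh : ∀ δ {a b} → IsComposition a → IsComposition b → count (qsh a b) δ ≡ convolution (mono a) (mono b) δ
count-qsh []          {[]}    {[]}    pa pb = trans (∑-[-] _ _) (sym (∑-[-] _ _))
count-qsh []          {[]}    {_ ∷ _} pa pb = trans (∑-[-] _ _) (sym (∑-[-] _ _))
count-qsh []          {_ ∷ _} {[]}    pa pb = trans (∑-[-] _ _) (sym (∑-[-] _ _))
count-qsh []          {x ∷ a} {y ∷ b} pa pb = begin
  count (qsh (x ∷ a) (y ∷ b)) []
    ≡⟨ trans (∑-++ (map (x ∷_) _) _ _) (cong (count (map (x ∷_) (qsh a (y ∷ b))) [] +ℚ_) (∑-++ (map (y ∷_) _) (map ((x + y) ∷_) _) _)) ⟩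
  count (map (x ∷_) (qsh a (y ∷ b))) [] +ℚ (count (map (y ∷_) (qsh (x ∷ a) b)) [] +ℚ count (map ((x + y) ∷_) (qsh a b)) [])
    ≡⟨ cong₂ _+ℚ_ (count-map-∷-[] x (qsh a (y ∷ b))) (cong₂ _+ℚ_ (count-map-∷-[] y (qsh (x ∷ a) b)) (count-map-∷-[] (x + y) (qsh a b))) ⟩
  0ℚ
    ≡⟨ ∑-[-] _ _ ⟨
  convolution (mono (x ∷ a)) (mono (y ∷ b)) [] ∎
count-qsh (zero ∷ δ)  {a}     {b}     pa pb = begin
  count (qsh a b) δ ≡⟨ count-qsh δ pa pb ⟩
  convolution (mono a) (mono b) δ ≡⟨ trans (∑-decomps-∷ zero δ _) (∑-[-] _ _) ⟨
  convolution (mono a) (mono b) (zero ∷ δ) ∎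
count-qsh (suc d ∷ δ) {[]}    {[]}    pa pb = begin
  count ([] ∷ []) (suc d ∷ δ)                         ≡⟨ ∑-[-] _ _ ⟩
  0ℚ                                                  ≡⟨ convolution-zeroʳ (mono []) δ ⟨
  convolution (mono []) (λ _ → 0ℚ) δ                  ≡⟨ convolution-mono-[] (mono []) d δ ⟨
  convolution (mono []) (mono []) (suc d ∷ δ)         ∎
count-qsh (suc d ∷ δ) {[]}    {y ∷ b} pa (_ ∷ pb) = begin
  count ((y ∷ b) ∷ []) (suc d ∷ δ)                          ≡⟨ trans (∑-[-] _ _) (mono-∷-suc y b d δ) ⟩
  ⟦ y ≡ᵇ suc d ⟧ *ℚ mono b δ                                ≡⟨ cong (⟦ y ≡ᵇ suc d ⟧ *ℚ_) (trans (sym (∑-[-] b _)) (count-qsh δ pa pb)) ⟩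
  ⟦ y ≡ᵇ suc d ⟧ *ℚ convolution (mono []) (mono b) δ        ≡⟨ convolutionʳ-mono-∷ (mono []) y b d δ ⟨
  convolution (mono []) (λ v → mono (y ∷ b) (suc d ∷ v)) δ  ≡⟨ convolution-mono-[] (mono (y ∷ b)) d δ ⟨
  convolution (mono []) (mono (y ∷ b)) (suc d ∷ δ)          ∎
count-qsh (suc d ∷ δ) {suc p ∷ a} {[]}    (_ ∷ pa) pb = begin
  count ((suc p ∷ a) ∷ []) (suc d ∷ δ)
    ≡⟨ trans (∑-[-] _ _) (mono-∷-suc (suc p) a d δ) ⟩
  ⟦ p ≡ᵇ d ⟧ *ℚ mono a δ
    ≡⟨ cong (⟦ p ≡ᵇ d ⟧ *ℚ_) (trans (sym (trans (cong (λ l → count l δ) (qsh-[] a)) (∑-[-] a _))) (count-qsh δ pa pb)) ⟩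
  ⟦ p ≡ᵇ d ⟧ *ℚ convolution (mono a) (mono []) δ
    -- With an empty right factor there is no merged part; a zero term with the dummy `q = 0` is
    -- added to reach the shape of `∑-sub-two`.
    ≡⟨ solve 2 (λ x y → x := con 0ℚ :+ (x :+ y :* con 0ℚ)) refl (⟦ p ≡ᵇ d ⟧ *ℚ convolution (mono a) (mono []) δ) ⟦ p + 1 ≡ᵇ d ⟧ ⟩
  0ℚ +ℚ (⟦ p ≡ᵇ d ⟧ *ℚ convolution (mono a) (mono []) δ +ℚ ⟦ p + 1 ≡ᵇ d ⟧ *ℚ 0ℚ)
    ≡⟨ cong₂ _+ℚ_ (convolution-zeroʳ (mono (suc p ∷ a)) δ)
         (∑-sub-two p 0 d (λ j → convolution (mono a) (λ v → mono [] (j ∷ v)) δ) _ 0ℚ refl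
           (λ j → trans (convolution-zeroʳ (mono a) δ) (sym (ℚₚ.*-zeroʳ ⟦ 0 ≡ᵇ j ⟧)))) ⟨
  convolution (mono (suc p ∷ a)) (λ _ → 0ℚ) δ +ℚ ∑ (sub p d) (λ j → convolution (mono a) (λ v → mono [] (j ∷ v)) δ)
    ≡⟨ convolution-mono-∷ p a (mono []) d δ ⟨
  convolution (mono (suc p ∷ a)) (mono []) (suc d ∷ δ) ∎
  where
  qsh-[] : ∀ a → qsh a [] ≡ a ∷ []
  qsh-[] []      = refl
  qsh-[] (_ ∷ _) = refl
count-qsh (suc d ∷ δ) {A@(suc p ∷ a)} {B@(suc q ∷ b)} (px ∷ pa) (py ∷ pb) = begin
  count (qsh A B) (suc d ∷ δ)
    ≡⟨ trans (∑-++ (map (suc p ∷_) _) _ _) (cong (count (map (suc p ∷_) (qsh a B)) (suc d ∷ δ) +ℚ_) (∑-++ (map (suc q ∷_) _) (map ((suc p + suc q) ∷_) _) _)) ⟩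
  count (map (suc p ∷_) (qsh a B)) (suc d ∷ δ) +ℚ (count (map (suc q ∷_) (qsh A b)) (suc d ∷ δ) +ℚ count (map ((suc p + suc q) ∷_) (qsh a b)) (suc d ∷ δ))
    ≡⟨ cong₂ _+ℚ_ (step (suc p) (py ∷ pb) pa) (cong₂ _+ℚ_ (step (suc q) pb (px ∷ pa)) (step (suc p + suc q) pb pa)) ⟩
  ⟦ p ≡ᵇ d ⟧ *ℚ convolution (mono a) (mono B) δ +ℚ (⟦ q ≡ᵇ d ⟧ *ℚ convolution (mono A) (mono b) δ +ℚ ⟦ p + suc q ≡ᵇ d ⟧ *ℚ convolution (mono a) (mono b) δ)
    ≡⟨ solve 3 (λ x y z → x :+ (y :+ z) := y :+ (x :+ z)) refl (⟦ p ≡ᵇ d ⟧ *ℚ convolution (mono a) (mono B) δ) (⟦ q ≡ᵇ d ⟧ *ℚ convolution (mono A) (mono b) δ) (⟦ p + suc q ≡ᵇ d ⟧ *ℚ convolution (mono a) (mono b) δ) ⟩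
  ⟦ q ≡ᵇ d ⟧ *ℚ convolution (mono A) (mono b) δ +ℚ (⟦ p ≡ᵇ d ⟧ *ℚ convolution (mono a) (mono B) δ +ℚ ⟦ p + suc q ≡ᵇ d ⟧ *ℚ convolution (mono a) (mono b) δ)
    -- If `A` does not use the first variable, `B` must. Otherwise the leftover exponent is zero or
    -- the first part of `B`, which gives the other two families of the quasi-shuffle.
    ≡⟨ cong₂ _+ℚ_ (convolutionʳ-mono-∷ (mono A) (suc q) b d δ)
         (∑-sub-two p q d (λ j → convolution (mono a) (λ v → mono B (j ∷ v)) δ) _ _ refl
           (λ j → convolutionʳ-mono-∷ (mono a) (suc q) b j δ)) ⟨
  convolution (mono A) (λ v → mono B (suc d ∷ v)) δ +ℚ ∑ (sub p d) (λ j → convolution (mono a) (λ v → mono B (j ∷ v)) δ)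
    ≡⟨ convolution-mono-∷ p a (mono B) d δ ⟨
  convolution (mono A) (mono B) (suc d ∷ δ) ∎
  where
  step : ∀ x {a b} → IsComposition b → IsComposition a →
    count (map (x ∷_) (qsh a b)) (suc d ∷ δ) ≡ ⟦ x ≡ᵇ suc d ⟧ *ℚ convolution (mono a) (mono b) δ
  step x {a} {b} pb pa = trans (count-map-∷ x (qsh a b) d δ) (cong (⟦ x ≡ᵇ suc d ⟧ *ℚ_) (count-qsh δ pa pb))

Positive : LinComb → Set
Positive = All (λ t → IsComposition (proj₂ t))

val-mulL : ∀ {f g} → Positive f → Positive g → ∀ δ → val (mulL f g) δ ≡ convolution (val f) (val g) δ
val-mulL {f} {g} pf pg δ = begin
  val (mulL f g) δ
    ≡⟨ val-∑ (mulL f g) δ ⟩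
  ∑ (mulL f g) (λ t → proj₁ t *ℚ mono (proj₂ t) δ)
    ≡⟨ trans (∑-concatMap _ f _) (∑-cong f (λ s → trans (∑-concatMap _ g _) (∑-cong g (λ t →
         trans (∑-map _ (qsh (proj₂ s) (proj₂ t)) _) (∑-*ˡ (qsh (proj₂ s) (proj₂ t)) (proj₁ s *ℚ proj₁ t) _))))) ⟩
  ∑ f (λ s → ∑ g (λ t → (proj₁ s *ℚ proj₁ t) *ℚ count (qsh (proj₂ s) (proj₂ t)) δ))
    ≡⟨ ∑-cong-All pf (λ {s} ps → ∑-cong-All pg (λ {t} pt → trans (cong ((proj₁ s *ℚ proj₁ t) *ℚ_) (count-qsh δ ps pt)) (sym (∑-*ˡ (decomps δ) (proj₁ s *ℚ proj₁ t) _)))) ⟩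
  ∑ f (λ s → ∑ g (λ t → ∑ (decomps δ) (λ q → (proj₁ s *ℚ proj₁ t) *ℚ (mono (proj₂ s) (proj₁ q) *ℚ mono (proj₂ t) (proj₂ q)))))
    ≡⟨ trans (∑-cong f (λ s → ∑-swap g (decomps δ) _)) (∑-swap f (decomps δ) _) ⟩
  ∑ (decomps δ) (λ q → ∑ f (λ s → ∑ g (λ t → (proj₁ s *ℚ proj₁ t) *ℚ (mono (proj₂ s) (proj₁ q) *ℚ mono (proj₂ t) (proj₂ q)))))
    ≡⟨ ∑-cong (decomps δ) (λ q → factor (proj₁ q) (proj₂ q)) ⟩
  convolution (val f) (val g) δ ∎
  where
  factor : ∀ u v → ∑ f (λ s → ∑ g (λ t → (proj₁ s *ℚ proj₁ t) *ℚ (mono (proj₂ s) u *ℚ mono (proj₂ t) v))) ≡ val f u *ℚ val g v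
  factor u v = begin
    ∑ f (λ s → ∑ g (λ t → (proj₁ s *ℚ proj₁ t) *ℚ (mono (proj₂ s) u *ℚ mono (proj₂ t) v)))
      ≡⟨ ∑-cong f (λ s → trans (∑-cong g (λ t → solve 4 (λ a b c d → (a :* b) :* (c :* d) := (a :* c) :* (b :* d)) refl (proj₁ s) (proj₁ t) (mono (proj₂ s) u) (mono (proj₂ t) v)))
           (∑-*ˡ g (proj₁ s *ℚ mono (proj₂ s) u) _)) ⟩
    ∑ f (λ s → (proj₁ s *ℚ mono (proj₂ s) u) *ℚ ∑ g (λ t → proj₁ t *ℚ mono (proj₂ t) v))
      ≡⟨ ∑-*ʳ f _ _ ⟩
    ∑ f (λ s → proj₁ s *ℚ mono (proj₂ s) u) *ℚ ∑ g (λ t → proj₁ t *ℚ mono (proj₂ t) v)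
      ≡⟨ cong₂ _*ℚ_ (val-∑ f u) (val-∑ g v) ⟨
    val f u *ℚ val g v ∎

qsh-positive : ∀ {a b} → IsComposition a → IsComposition b → All IsComposition (qsh a b)
qsh-positive []        pb        = pb ∷ []
qsh-positive (px ∷ pa) []        = (px ∷ pa) ∷ []
qsh-positive (px ∷ pa) (py ∷ pb) = Allₚ.++⁺ (Allₚ.map⁺ (All.map (px ∷_) (qsh-positive pa (py ∷ pb))))
  (Allₚ.++⁺ (Allₚ.map⁺ (All.map (py ∷_) (qsh-positive (px ∷ pa) pb)))
    (Allₚ.map⁺ (All.map (ℕₚ.≤-trans px (ℕₚ.m≤m+n _ _) ∷_) (qsh-positive pa pb))))

mulL-positive : ∀ {f g} → Positive f → Positive g → Positive (mulL f g)
mulL-positive pf pg = Allₚ.concat⁺ (Allₚ.map⁺ (All.map (λ ps → Allₚ.concat⁺ (Allₚ.map⁺ (All.map (λ pt → Allₚ.map⁺ (qsh-positive ps pt)) pg))) pf))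

-- `_≈L_` also compares coefficients at words with a zero part, which are never of the form
-- `nonzeros δ`; this covers them.
coeff-nonpositive : ∀ {f γ} → Positive f → ¬ IsComposition γ → coeff f γ ≡ 0ℚ
coeff-nonpositive {f} {γ} pf nγ = trans (coeff-∑ f γ) (trans
  (∑-cong-All pf (λ {t} pt → trans (cong (λ b → proj₁ t *ℚ ⟦ b ⟧) (==-≢ (λ e → nγ (subst IsComposition e pt)))) (ℚₚ.*-zeroʳ (proj₁ t))))
  (∑-zero f (λ _ → refl)))

-- Sums over compositions

-- `compositions` grows by prepending 1 or incrementing the head; sorting by the first part instead
-- matches products of power sums and the cutting of blocks.
∑-compositions-suc : ∀ n (F : List ℕ → ℚ) →
  ∑ (compositions (suc n)) F ≡ ∑ (splits n) (λ p → ∑ (compositions (proj₂ p)) (λ a → F (suc (proj₁ p) ∷ a)))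
∑-compositions-suc zero    F = trans (∑-[-] _ F) (sym (trans (∑-[-] _ _) (∑-[-] _ _)))
∑-compositions-suc (suc n) F = begin
  ∑ (compositions (suc (suc n))) F
    ≡⟨ ∑-concatMap _ (compositions (suc n)) F ⟩
  ∑ (compositions (suc n)) (λ c → ∑ ((1 ∷ c) ∷ incHead c ∷ []) F)
    ≡⟨ ∑-cong (compositions (suc n)) (λ c → trans (∑-∷ _ _ F) (cong (F (1 ∷ c) +ℚ_) (∑-[-] _ F))) ⟩
  ∑ (compositions (suc n)) (λ c → F (1 ∷ c) +ℚ F (incHead c))
    ≡⟨ ∑-+ (compositions (suc n)) _ _ ⟩
  ∑ (compositions (suc n)) (λ c → F (1 ∷ c)) +ℚ ∑ (compositions (suc n)) (λ c → F (incHead c))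
    ≡⟨ cong (∑ (compositions (suc n)) (λ c → F (1 ∷ c)) +ℚ_) (∑-compositions-suc n (λ c → F (incHead c))) ⟩
  ∑ (compositions (suc n)) (λ c → F (1 ∷ c)) +ℚ ∑ (splits n) (λ p → ∑ (compositions (proj₂ p)) (λ a → F (suc (suc (proj₁ p)) ∷ a)))
    ≡⟨ ∑-splits-suc n _ ⟨
  ∑ (splits (suc n)) (λ p → ∑ (compositions (proj₂ p)) (λ a → F (suc (proj₁ p) ∷ a))) ∎

infix 4 _⊨_
_⊨_ : Composition → ℕ → Set
a ⊨ n = IsComposition a × sum a ≡ n

compositions-⊨ : ∀ n → All (_⊨ n) (compositions n)
compositions-⊨ zero          = ([] , refl) ∷ []
compositions-⊨ (suc zero)    = (s≤s z≤n ∷ [] , refl) ∷ []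
compositions-⊨ (suc (suc n)) = Allₚ.concat⁺ (Allₚ.map⁺ (All.map step (compositions-⊨ (suc n))))
  where
  step : ∀ {c} → c ⊨ suc n → All (_⊨ suc (suc n)) ((1 ∷ c) ∷ incHead c ∷ [])
  step {x ∷ c} (px ∷ pc , e) = (s≤s z≤n ∷ px ∷ pc , cong suc e) ∷ (s≤s z≤n ∷ pc , cong suc e) ∷ []

-- Expresses, in the form in which it is used, that `compositions n` lists each composition of `n`
-- exactly once and no other.
∑-compositions-pick : ∀ n {γ} → IsComposition γ → (F : List ℕ → ℚ) →
  ∑ (compositions n) (λ c → ⟦ c == γ ⟧ *ℚ F c) ≡ ⟦ sum γ ≡ᵇ n ⟧ *ℚ F γ
∑-compositions-pick zero    {[]}    pγ F = ∑-[-] _ _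
∑-compositions-pick zero    {suc g ∷ γ} (_ ∷ pγ) F = trans (∑-[-] _ _) (trans (ℚₚ.*-zeroˡ (F [])) (sym (ℚₚ.*-zeroˡ (F (suc g ∷ γ)))))
∑-compositions-pick (suc n) {[]}    pγ F = begin
  ∑ (compositions (suc n)) (λ c → ⟦ c == [] ⟧ *ℚ F c)
    ≡⟨ ∑-compositions-suc n _ ⟩
  ∑ (splits n) (λ p → ∑ (compositions (proj₂ p)) (λ a → 0ℚ *ℚ F (suc (proj₁ p) ∷ a)))
    ≡⟨ ∑-zero (splits n) (λ p → ∑-zero (compositions (proj₂ p)) (λ a → ℚₚ.*-zeroˡ (F (suc (proj₁ p) ∷ a)))) ⟩
  0ℚ ≡⟨ ℚₚ.*-zeroˡ (F []) ⟨
  0ℚ *ℚ F [] ∎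
∑-compositions-pick (suc n) {suc g ∷ γ} (_ ∷ pγ) F = begin
  ∑ (compositions (suc n)) (λ c → ⟦ c == (suc g ∷ γ) ⟧ *ℚ F c)
    ≡⟨ ∑-compositions-suc n _ ⟩
  ∑ (splits n) (λ p → ∑ (compositions (proj₂ p)) (λ a → ⟦ (suc (proj₁ p) ∷ a) == (suc g ∷ γ) ⟧ *ℚ F (suc (proj₁ p) ∷ a)))
    ≡⟨ ∑-cong (splits n) (λ p → trans (∑-cong (compositions (proj₂ p)) (λ a → trans
         (cong (_*ℚ F (suc (proj₁ p) ∷ a)) (⟦==-∷⟧ (suc (proj₁ p)) a (suc g) γ))
         (ℚₚ.*-assoc ⟦ proj₁ p ≡ᵇ g ⟧ ⟦ a == γ ⟧ (F (suc (proj₁ p) ∷ a)))))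
         (∑-*ˡ (compositions (proj₂ p)) ⟦ proj₁ p ≡ᵇ g ⟧ _)) ⟩
  ∑ (splits n) (λ p → ⟦ proj₁ p ≡ᵇ g ⟧ *ℚ ∑ (compositions (proj₂ p)) (λ a → ⟦ a == γ ⟧ *ℚ F (suc (proj₁ p) ∷ a)))
    ≡⟨ ∑-cong (splits n) (λ p → at-g (proj₁ p) (proj₂ p)) ⟩
  ∑ (splits n) (λ p → ⟦ g ≡ᵇ proj₁ p ⟧ *ℚ (⟦ sum γ ≡ᵇ proj₂ p ⟧ *ℚ F (suc g ∷ γ)))
    ≡⟨ ∑-sub-pick g n (λ m → ⟦ sum γ ≡ᵇ m ⟧ *ℚ F (suc g ∷ γ)) ⟩
  ∑ (sub g n) (λ m → ⟦ sum γ ≡ᵇ m ⟧ *ℚ F (suc g ∷ γ))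
    ≡⟨ at-sub g n (F (suc g ∷ γ)) ⟩
  ⟦ g + sum γ ≡ᵇ n ⟧ *ℚ F (suc g ∷ γ) ∎
  where
  at-g : ∀ i j → ⟦ i ≡ᵇ g ⟧ *ℚ ∑ (compositions j) (λ a → ⟦ a == γ ⟧ *ℚ F (suc i ∷ a))
    ≡ ⟦ g ≡ᵇ i ⟧ *ℚ (⟦ sum γ ≡ᵇ j ⟧ *ℚ F (suc g ∷ γ))
  at-g i j rewrite ≡ᵇ-comm i g with g ≡ᵇ i in e
  ... | false = trans (ℚₚ.*-zeroˡ (∑ (compositions j) (λ a → ⟦ a == γ ⟧ *ℚ F (suc i ∷ a)))) (sym (ℚₚ.*-zeroˡ (⟦ sum γ ≡ᵇ j ⟧ *ℚ F (suc g ∷ γ))))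
  ... | true with ℕₚ.≡ᵇ⇒≡ g i (subst T (sym e) _)
  ...   | refl = cong (1ℚ *ℚ_) (∑-compositions-pick j pγ (λ a → F (suc g ∷ a)))
  at-sub : ∀ g n x → ∑ (sub g n) (λ m → ⟦ sum γ ≡ᵇ m ⟧ *ℚ x) ≡ ⟦ g + sum γ ≡ᵇ n ⟧ *ℚ x
  at-sub zero    n       x = ∑-[-] _ _
  at-sub (suc g) zero    x = trans (∑-[] _) (sym (ℚₚ.*-zeroˡ x))
  at-sub (suc g) (suc n) x = at-sub g n x

-- Multiplication by p_k and h_n

mono-[]-convolution : ∀ g δ → convolution (mono []) g δ ≡ g δ
mono-[]-convolution g []          = trans (∑-[-] _ _) (ℚₚ.*-identityˡ (g []))
mono-[]-convolution g (zero  ∷ δ) = trans (∑-decomps-∷ 0 δ _) (trans (∑-[-] _ _) (mono-[]-convolution (λ v → g (0 ∷ v)) δ))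
mono-[]-convolution g (suc d ∷ δ) = trans (convolution-mono-[] g d δ) (mono-[]-convolution (λ v → g (suc d ∷ v)) δ)

mono-[k]-convolution : ∀ k g δ → convolution (mono (suc k ∷ [])) g δ ≡ ∑ (lower (suc k) δ) g
mono-[k]-convolution k g []          = trans (∑-[-] _ _) (trans (ℚₚ.*-zeroˡ (g [])) (sym (∑-[] g)))
mono-[k]-convolution k g (zero  ∷ δ) = begin
  convolution (mono (suc k ∷ [])) g (zero ∷ δ)               ≡⟨ trans (∑-decomps-∷ 0 δ _) (∑-[-] _ _) ⟩
  convolution (mono (suc k ∷ [])) (λ v → g (0 ∷ v)) δ        ≡⟨ mono-[k]-convolution k (λ v → g (0 ∷ v)) δ ⟩
  ∑ (lower (suc k) δ) (λ v → g (0 ∷ v))                      ≡⟨ ∑-map _ (lower (suc k) δ) g ⟨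
  ∑ (lower (suc k) (zero ∷ δ)) g                             ∎
mono-[k]-convolution k g (suc d ∷ δ) = begin
  convolution (mono (suc k ∷ [])) g (suc d ∷ δ)
    ≡⟨ convolution-mono-∷ k [] g d δ ⟩
  convolution (mono (suc k ∷ [])) (λ v → g (suc d ∷ v)) δ +ℚ ∑ (sub k d) (λ j → convolution (mono []) (λ v → g (j ∷ v)) δ)
    ≡⟨ cong₂ _+ℚ_ (mono-[k]-convolution k (λ v → g (suc d ∷ v)) δ) (∑-cong (sub k d) (λ j → mono-[]-convolution (λ v → g (j ∷ v)) δ)) ⟩
  ∑ (lower (suc k) δ) (λ v → g (suc d ∷ v)) +ℚ ∑ (sub k d) (λ j → g (j ∷ δ))
    ≡⟨ ℚₚ.+-comm (∑ (lower (suc k) δ) (λ v → g (suc d ∷ v))) (∑ (sub k d) (λ j → g (j ∷ δ))) ⟩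
  ∑ (sub (suc k) (suc d)) (λ j → g (j ∷ δ)) +ℚ ∑ (lower (suc k) δ) (λ v → g (suc d ∷ v))
    ≡⟨ ∑-lower-∷ (suc k) (suc d) δ g ⟨
  ∑ (lower (suc k) (suc d ∷ δ)) g ∎

pL-positive : ∀ k → Positive (pL k)
pL-positive zero    = []
pL-positive (suc k) = (s≤s z≤n ∷ []) ∷ []

hL-positive : ∀ n → Positive (hL n)
hL-positive n = Allₚ.map⁺ (All.map proj₁ (compositions-⊨ n))

pProd-positive : ∀ α → Positive (pProd α)
pProd-positive []      = [] ∷ []
pProd-positive (a ∷ α) = mulL-positive (pL-positive a) (pProd-positive α)

hProd-positive : ∀ β → Positive (hProd β)
hProd-positive []      = [] ∷ []
hProd-positive (b ∷ β) = mulL-positive (hL-positive b) (hProd-positive β)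

val-p* : ∀ k {g} → Positive g → ∀ δ → val (mulL (pL (suc k)) g) δ ≡ inv (suc k) *ℚ ∑ (lower (suc k) δ) (val g)
val-p* k {g} pg δ = begin
  val (mulL (pL (suc k)) g) δ
    ≡⟨ val-mulL (pL-positive (suc k)) pg δ ⟩
  convolution (val (pL (suc k))) (val g) δ
    ≡⟨ ∑-cong (decomps δ) (λ q → trans (cong (_*ℚ val g (proj₂ q)) (trans (val-∑ (pL (suc k)) (proj₁ q)) (∑-[-] _ _)))
         (ℚₚ.*-assoc (inv (suc k)) (mono (suc k ∷ []) (proj₁ q)) (val g (proj₂ q)))) ⟩
  ∑ (decomps δ) (λ q → inv (suc k) *ℚ (mono (suc k ∷ []) (proj₁ q) *ℚ val g (proj₂ q)))
    ≡⟨ ∑-*ˡ (decomps δ) (inv (suc k)) _ ⟩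
  inv (suc k) *ℚ convolution (mono (suc k ∷ [])) (val g) δ
    ≡⟨ cong (inv (suc k) *ℚ_) (mono-[k]-convolution k (val g) δ) ⟩
  inv (suc k) *ℚ ∑ (lower (suc k) δ) (val g) ∎

-- Multiplication by h_n: every monomial of degree `n` has coefficient 1 in h_n.
h* : (List ℕ → ℚ) → ℕ → List ℕ → ℚ
h* f n δ = convolution (λ a → ⟦ sum a ≡ᵇ n ⟧) f δ

val-h* : ∀ n {g} → Positive g → ∀ δ → val (mulL (hL n) g) δ ≡ h* (val g) n δ
val-h* n {g} pg δ = trans (val-mulL (hL-positive n) pg δ) (∑-cong (decomps δ) (λ q → cong (_*ℚ val g (proj₂ q)) (val-hL (proj₁ q))))
  where
  val-hL : ∀ a → val (hL n) a ≡ ⟦ sum a ≡ᵇ n ⟧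
  val-hL a = begin
    val (hL n) a
      ≡⟨ trans (val-∑ (hL n) a) (∑-map _ (compositions n) _) ⟩
    ∑ (compositions n) (λ c → 1ℚ *ℚ mono c a)
      ≡⟨ ∑-cong (compositions n) (λ c → ℚₚ.*-comm 1ℚ (mono c a)) ⟩
    ∑ (compositions n) (λ c → mono c a *ℚ 1ℚ)
      ≡⟨ ∑-compositions-pick n (nonzeros-positive a) (λ _ → 1ℚ) ⟩
    ⟦ sum (nonzeros a) ≡ᵇ n ⟧ *ℚ 1ℚ
      ≡⟨ trans (ℚₚ.*-identityʳ ⟦ sum (nonzeros a) ≡ᵇ n ⟧) (cong (λ s → ⟦ s ≡ᵇ n ⟧) (sum-nonzeros a)) ⟩
    ⟦ sum a ≡ᵇ n ⟧ ∎

h*-zero : ∀ f δ → h* f 0 δ ≡ f δ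
h*-zero f δ = trans (∑-cong (decomps δ) (λ q → cong (λ b → ⟦ b ⟧ *ℚ f (proj₂ q)) (sum≡0 (proj₁ q)))) (mono-[]-convolution f δ)
  where
  sum≡0 : ∀ a → (sum a ≡ᵇ 0) ≡ ([] == nonzeros a)
  sum≡0 []          = refl
  sum≡0 (zero  ∷ a) = sum≡0 a
  sum≡0 (suc _ ∷ a) = refl

-- Newton-type recursions

-- The index is the degree of a multiplier, such as h_n, of a fixed function; it is not tied to the
-- degree of the monomial δ.
Series : Set
Series = ℕ → List ℕ → ℚ

-- Multiplication by the series ∑ w_k M_(k), graded by degree.
𝒯 : (ℕ → ℚ) → Series → Series
𝒯 w A n δ = ∑ (splits n) (λ p → w (proj₁ p) *ℚ ∑ (lower (proj₁ p) δ) (A (proj₂ p)))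

𝒯-cong : ∀ w {A B : Series} → (∀ m → A m ≐ B m) → ∀ n δ → 𝒯 w A n δ ≡ 𝒯 w B n δ
𝒯-cong w e n δ = ∑-cong (splits n) (λ p → cong (w (proj₁ p) *ℚ_) (∑-cong (lower (proj₁ p) δ) (e (proj₂ p))))

-- Since the weight vanishes at 0, degree `n` of the result reads only degrees below `n`; strong
-- induction on the degree rests on this.
𝒯-cong-< : ∀ w → w 0 ≡ 0ℚ → ∀ {A B : Series} n → (∀ {m} → m < n → A m ≐ B m) → ∀ δ → 𝒯 w A n δ ≡ 𝒯 w B n δ
𝒯-cong-< w w0 {A} {B} n e δ = ∑-cong-All (splits-sum n) (λ { {p} s → at (proj₁ p) (proj₂ p) s })
  where
  at : ∀ k m → k + m ≡ n → w k *ℚ ∑ (lower k δ) (A m) ≡ w k *ℚ ∑ (lower k δ) (B m)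
  at zero    m s = trans (trans (cong (_*ℚ ∑ (lower 0 δ) (A m)) w0) (ℚₚ.*-zeroˡ (∑ (lower 0 δ) (A m))))
    (sym (trans (cong (_*ℚ ∑ (lower 0 δ) (B m)) w0) (ℚₚ.*-zeroˡ (∑ (lower 0 δ) (B m)))))
  at (suc k) m s = cong (w (suc k) *ℚ_) (∑-cong (lower (suc k) δ) (e (subst (m <_) s (s≤s (ℕₚ.m≤n+m m k)))))

𝒯-+ : ∀ w A B n δ → 𝒯 w (λ m ε → A m ε +ℚ B m ε) n δ ≡ 𝒯 w A n δ +ℚ 𝒯 w B n δ
𝒯-+ w A B n δ = trans (∑-cong (splits n) (λ p → trans (cong (w (proj₁ p) *ℚ_) (∑-+ (lower (proj₁ p) δ) (A (proj₂ p)) (B (proj₂ p))))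
  (ℚₚ.*-distribˡ-+ (w (proj₁ p)) (∑ (lower (proj₁ p) δ) (A (proj₂ p))) (∑ (lower (proj₁ p) δ) (B (proj₂ p)))))) (∑-+ (splits n) _ _)

𝒯-* : ∀ w c A n δ → 𝒯 w (λ m ε → c *ℚ A m ε) n δ ≡ c *ℚ 𝒯 w A n δ
𝒯-* w c A n δ = trans (∑-cong (splits n) (λ p → trans (cong (w (proj₁ p) *ℚ_) (∑-*ˡ (lower (proj₁ p) δ) c (A (proj₂ p))))
  (solve 3 (λ x y z → x :* (y :* z) := y :* (x :* z)) refl (w (proj₁ p)) c (∑ (lower (proj₁ p) δ) (A (proj₂ p)))))) (∑-*ˡ (splits n) c _)

𝒯-weight-+ : ∀ w v A n δ → 𝒯 (λ k → w k +ℚ v k) A n δ ≡ 𝒯 w A n δ +ℚ 𝒯 v A n δ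
𝒯-weight-+ w v A n δ = trans (∑-cong (splits n) (λ p → ℚₚ.*-distribʳ-+ (∑ (lower (proj₁ p) δ) (A (proj₂ p))) (w (proj₁ p)) (v (proj₁ p)))) (∑-+ (splits n) _ _)

𝒯-weight-cong : ∀ {w v} → w ≐ v → ∀ A n δ → 𝒯 w A n δ ≡ 𝒯 v A n δ
𝒯-weight-cong e A n δ = ∑-cong (splits n) (λ p → cong (_*ℚ ∑ (lower (proj₁ p) δ) (A (proj₂ p))) (e (proj₁ p)))

𝒯-weight-zero : ∀ A n δ → 𝒯 (λ _ → 0ℚ) A n δ ≡ 0ℚ
𝒯-weight-zero A n δ = ∑-zero (splits n) (λ p → ℚₚ.*-zeroˡ (∑ (lower (proj₁ p) δ) (A (proj₂ p))))

𝒯-at-zero : ∀ {w} → w 0 ≡ 0ℚ → ∀ A δ → 𝒯 w A 0 δ ≡ 0ℚ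
𝒯-at-zero w0 A δ = trans (∑-[-] _ _) (trans (cong (_*ℚ ∑ (lower 0 δ) (A 0)) w0) (ℚₚ.*-zeroˡ (∑ (lower 0 δ) (A 0))))

𝒯-suc : ∀ {w} → w 0 ≡ 0ℚ → ∀ A n δ → 𝒯 w A (suc n) δ ≡ ∑ (splits n) (λ p → w (suc (proj₁ p)) *ℚ ∑ (lower (suc (proj₁ p)) δ) (A (proj₂ p)))
𝒯-suc {w} w0 A n δ = trans (∑-splits-suc n _) (trans
  (cong (_+ℚ r) (trans (cong (_*ℚ ∑ (lower 0 δ) (A (suc n))) w0) (ℚₚ.*-zeroˡ (∑ (lower 0 δ) (A (suc n)))))) (ℚₚ.+-identityˡ r))
  where r = ∑ (splits n) (λ p → w (suc (proj₁ p)) *ℚ ∑ (lower (suc (proj₁ p)) δ) (A (proj₂ p)))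

-- Leibniz rule for the Euler operator, which multiplies degree n by n: in each term n = k + m,
-- where k goes to the weight and m to `A`.
euler-𝒯 : ∀ w A n δ → ι n *ℚ 𝒯 w A n δ ≡ 𝒯 w (λ m ε → ι m *ℚ A m ε) n δ +ℚ 𝒯 (λ k → ι k *ℚ w k) A n δ
euler-𝒯 w A n δ = begin
  ι n *ℚ 𝒯 w A n δ
    ≡⟨ ∑-*ˡ (splits n) (ι n) _ ⟨
  ∑ (splits n) (λ p → ι n *ℚ (w (proj₁ p) *ℚ a p))
    ≡⟨ ∑-cong-All (splits-sum n) (λ {p} s → trans (cong (λ z → z *ℚ (w (proj₁ p) *ℚ a p)) (trans (cong ι (sym s)) (ι-+ (proj₁ p) (proj₂ p))))
         (trans (solve 4 (λ k m w x → (k :+ m) :* (w :* x) := w :* (m :* x) :+ (k :* w) :* x) refl (ι (proj₁ p)) (ι (proj₂ p)) (w (proj₁ p)) (a p))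
           (cong (λ z → w (proj₁ p) *ℚ z +ℚ (ι (proj₁ p) *ℚ w (proj₁ p)) *ℚ a p) (sym (∑-*ˡ (lower (proj₁ p) δ) (ι (proj₂ p)) (A (proj₂ p))))))) ⟩
  ∑ (splits n) (λ p → w (proj₁ p) *ℚ ∑ (lower (proj₁ p) δ) (λ ε → ι (proj₂ p) *ℚ A (proj₂ p) ε) +ℚ (ι (proj₁ p) *ℚ w (proj₁ p)) *ℚ a p)
    ≡⟨ ∑-+ (splits n) _ _ ⟩
  𝒯 w (λ m ε → ι m *ℚ A m ε) n δ +ℚ 𝒯 (λ k → ι k *ℚ w k) A n δ ∎
  where
  a : ℕ × ℕ → ℚ
  a p = ∑ (lower (proj₁ p) δ) (A (proj₂ p))

∑-sub-sub : ∀ k l d (f : ℕ → ℚ) → ∑ (sub k d) (λ j → ∑ (sub l j) f) ≡ ∑ (sub (k + l) d) f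
∑-sub-sub zero    l d       f = ∑-[-] _ _
∑-sub-sub (suc k) l zero    f = trans (∑-[] _) (sym (∑-[] f))
∑-sub-sub (suc k) l (suc d) f = ∑-sub-sub k l d f

-- Multiplications by M_(k) and M_(l) commute. Either both lower the same exponent, which loses
-- `k + l`, or they lower two different ones; both situations are symmetric in `k` and `l`.
∑-lower-comm : ∀ k l δ (f : List ℕ → ℚ) → ∑ (lower k δ) (λ ε → ∑ (lower l ε) f) ≡ ∑ (lower l δ) (λ ε → ∑ (lower k ε) f)
∑-lower-comm k l []      f = trans (∑-[] _) (sym (∑-[] _))
∑-lower-comm k l (d ∷ δ) f = begin
  ∑ (lower k (d ∷ δ)) (λ ε → ∑ (lower l ε) f)
    ≡⟨ expand k l ⟩
  (∑ (sub (k + l) d) g +ℚ B k l) +ℚ (B l k +ℚ D k l)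
    ≡⟨ cong₂ (λ x y → (∑ (sub x d) g +ℚ B k l) +ℚ (B l k +ℚ y)) (ℕₚ.+-comm k l) (∑-lower-comm k l δ (λ ε → f (d ∷ ε))) ⟩
  (∑ (sub (l + k) d) g +ℚ B k l) +ℚ (B l k +ℚ D l k)
    ≡⟨ solve 4 (λ a b c d → (a :+ b) :+ (c :+ d) := (a :+ c) :+ (b :+ d)) refl (∑ (sub (l + k) d) g) (B k l) (B l k) (D l k) ⟩
  (∑ (sub (l + k) d) g +ℚ B l k) +ℚ (B k l +ℚ D l k)
    ≡⟨ expand l k ⟨
  ∑ (lower l (d ∷ δ)) (λ ε → ∑ (lower k ε) f) ∎
  where
  g : ℕ → ℚ
  g j = f (j ∷ δ)
  B D : ℕ → ℕ → ℚ
  B k l = ∑ (sub k d) (λ j → ∑ (lower l δ) (λ ε → f (j ∷ ε)))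
  D k l = ∑ (lower k δ) (λ ε → ∑ (lower l ε) (λ ε′ → f (d ∷ ε′)))
  expand : ∀ k l → ∑ (lower k (d ∷ δ)) (λ ε → ∑ (lower l ε) f) ≡ (∑ (sub (k + l) d) g +ℚ B k l) +ℚ (B l k +ℚ D k l)
  expand k l = begin
    ∑ (lower k (d ∷ δ)) (λ ε → ∑ (lower l ε) f)
      ≡⟨ ∑-lower-∷ k d δ _ ⟩
    ∑ (sub k d) (λ j → ∑ (lower l (j ∷ δ)) f) +ℚ ∑ (lower k δ) (λ ε → ∑ (lower l (d ∷ ε)) f)
      ≡⟨ cong₂ _+ℚ_ (trans (∑-cong (sub k d) (λ j → ∑-lower-∷ l j δ f)) (∑-+ (sub k d) _ _))
                    (trans (∑-cong (lower k δ) (λ ε → ∑-lower-∷ l d ε f)) (∑-+ (lower k δ) _ _)) ⟩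
    (∑ (sub k d) (λ j → ∑ (sub l j) g) +ℚ B k l) +ℚ (∑ (lower k δ) (λ ε → ∑ (sub l d) (λ j → f (j ∷ ε))) +ℚ D k l)
      ≡⟨ cong₂ (λ x y → (x +ℚ B k l) +ℚ (y +ℚ D k l)) (∑-sub-sub k l d g) (∑-swap (lower k δ) (sub l d) (λ ε j → f (j ∷ ε))) ⟩
    (∑ (sub (k + l) d) g +ℚ B k l) +ℚ (B l k +ℚ D k l) ∎

-- Needed so that the derivative of a power of `𝒯 w` collapses to a multiple of the next lower
-- power.
𝒯-comm : ∀ w v A n δ → 𝒯 w (𝒯 v A) n δ ≡ 𝒯 v (𝒯 w A) n δ
𝒯-comm w v A n δ = begin
  𝒯 w (𝒯 v A) n δ
    ≡⟨ expand w v ⟩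
  ∑ (splits n) (λ p → ∑ (splits (proj₂ p)) (λ q → (w (proj₁ p) *ℚ v (proj₁ q)) *ℚ ∑ (lower (proj₁ p) δ) (λ ε → ∑ (lower (proj₁ q) ε) (A (proj₂ q)))))
    ≡⟨ ∑-splits-exchange n (λ k l r → (w k *ℚ v l) *ℚ ∑ (lower k δ) (λ ε → ∑ (lower l ε) (A r))) ⟩
  ∑ (splits n) (λ p → ∑ (splits (proj₂ p)) (λ q → (w (proj₁ q) *ℚ v (proj₁ p)) *ℚ ∑ (lower (proj₁ q) δ) (λ ε → ∑ (lower (proj₁ p) ε) (A (proj₂ q)))))
    ≡⟨ ∑-cong (splits n) (λ p → ∑-cong (splits (proj₂ p)) (λ q → cong₂ _*ℚ_ (ℚₚ.*-comm (w (proj₁ q)) (v (proj₁ p))) (∑-lower-comm (proj₁ q) (proj₁ p) δ (A (proj₂ q))))) ⟩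
  ∑ (splits n) (λ p → ∑ (splits (proj₂ p)) (λ q → (v (proj₁ p) *ℚ w (proj₁ q)) *ℚ ∑ (lower (proj₁ p) δ) (λ ε → ∑ (lower (proj₁ q) ε) (A (proj₂ q)))))
    ≡⟨ expand v w ⟨
  𝒯 v (𝒯 w A) n δ ∎
  where
  expand : ∀ w v → 𝒯 w (𝒯 v A) n δ
    ≡ ∑ (splits n) (λ p → ∑ (splits (proj₂ p)) (λ q → (w (proj₁ p) *ℚ v (proj₁ q)) *ℚ ∑ (lower (proj₁ p) δ) (λ ε → ∑ (lower (proj₁ q) ε) (A (proj₂ q)))))
  expand w v = ∑-cong (splits n) (λ p → begin
    w (proj₁ p) *ℚ ∑ (lower (proj₁ p) δ) (𝒯 v A (proj₂ p))
      ≡⟨ cong (w (proj₁ p) *ℚ_) (∑-swap (lower (proj₁ p) δ) (splits (proj₂ p)) _) ⟩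
    w (proj₁ p) *ℚ ∑ (splits (proj₂ p)) (λ q → ∑ (lower (proj₁ p) δ) (λ ε → v (proj₁ q) *ℚ ∑ (lower (proj₁ q) ε) (A (proj₂ q))))
      ≡⟨ ∑-*ˡ (splits (proj₂ p)) (w (proj₁ p)) _ ⟨
    ∑ (splits (proj₂ p)) (λ q → w (proj₁ p) *ℚ ∑ (lower (proj₁ p) δ) (λ ε → v (proj₁ q) *ℚ ∑ (lower (proj₁ q) ε) (A (proj₂ q))))
      ≡⟨ ∑-cong (splits (proj₂ p)) (λ q → trans (cong (w (proj₁ p) *ℚ_) (∑-*ˡ (lower (proj₁ p) δ) (v (proj₁ q)) _))
           (sym (ℚₚ.*-assoc (w (proj₁ p)) (v (proj₁ q)) (∑ (lower (proj₁ p) δ) (λ ε → ∑ (lower (proj₁ q) ε) (A (proj₂ q))))))) ⟩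
    ∑ (splits (proj₂ p)) (λ q → (w (proj₁ p) *ℚ v (proj₁ q)) *ℚ ∑ (lower (proj₁ p) δ) (λ ε → ∑ (lower (proj₁ q) ε) (A (proj₂ q)))) ∎)

-- The equation E A = K A for the Euler operator E; K = ∑ κ_k M_(k) plays the part of the
-- logarithmic derivative of `A`.
Newton : (ℕ → ℚ) → Series → Set
Newton κ A = ∀ n δ → ι n *ℚ A n δ ≡ 𝒯 κ A n δ

Newton-unique : ∀ {κ A B} → κ 0 ≡ 0ℚ → Newton κ A → Newton κ B → A 0 ≐ B 0 → ∀ n → A n ≐ B n
Newton-unique {κ} {A} {B} κ0 nA nB e = <-rec (λ n → A n ≐ B n) step
  where
  step : ∀ n → (∀ {m} → m < n → A m ≐ B m) → A n ≐ B n
  step zero    rec δ = e δ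
  step (suc n) rec δ = ι-cancel n (trans (nA (suc n) δ) (trans (𝒯-cong-< κ κ0 (suc n) rec δ) (sym (nB (suc n) δ))))

-- Z p stands for ∑_ℓ 𝒯_w^ℓ B / (ℓ + p)!; in particular Z 0 = exp(𝒯_w) B, and n ↦ n Aₙ acts as a derivation on it.
module _ (w κ : ℕ → ℚ) (B : Series) (Z : ℕ → Series) (w0 : w 0 ≡ 0ℚ) (B-newton : Newton κ B)
         (Z-rec : ∀ p n δ → Z p n δ ≡ 𝒯 w (Z (suc p)) n δ +ℚ 1/! p *ℚ B n δ) where

  private
    w′ : ℕ → ℚ
    w′ k = ι k *ℚ w k

    -- Differentiating 𝒯_w^ℓ B / (ℓ + p)! produces the factor ℓ = (ℓ + p) - p: the first summand
    -- cancels into the factorial and gives `Z p`, the second gives -p times `Z (suc p)`. The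
    -- correction disappears at p = 0, but the induction on `n` needs every p because `Z-rec` passes
    -- from `p` to `suc p`.
    Z-Newton : ℕ → Set
    Z-Newton n = ∀ p δ → ι n *ℚ Z p n δ ≡ (𝒯 w′ (Z p) n δ +ℚ (-ℚ ι p) *ℚ 𝒯 w′ (Z (suc p)) n δ) +ℚ 𝒯 κ (Z p) n δ

    𝒯-Z : ∀ v p n δ → 𝒯 v (Z p) n δ ≡ 𝒯 v (𝒯 w (Z (suc p))) n δ +ℚ 1/! p *ℚ 𝒯 v B n δ
    𝒯-Z v p n δ = trans (𝒯-cong v (Z-rec p) n δ) (trans (𝒯-+ v _ _ n δ) (cong (𝒯 v (𝒯 w (Z (suc p))) n δ +ℚ_) (𝒯-* v (1/! p) B n δ)))

    Z-newton-step : ∀ n → (∀ {m} → m < n → Z-Newton m) → Z-Newton n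
    Z-newton-step n rec p δ = begin
      ι n *ℚ Z p n δ
        ≡⟨ cong (ι n *ℚ_) (Z-rec p n δ) ⟩
      ι n *ℚ (𝒯 w Z₁ n δ +ℚ f *ℚ B n δ)
        ≡⟨ solve 4 (λ n x f b → n :* (x :+ f :* b) := n :* x :+ f :* (n :* b)) refl (ι n) (𝒯 w Z₁ n δ) f (B n δ) ⟩
      ι n *ℚ 𝒯 w Z₁ n δ +ℚ f *ℚ (ι n *ℚ B n δ)
        ≡⟨ cong₂ (λ x z → x +ℚ f *ℚ z) (euler-𝒯 w Z₁ n δ) (B-newton n δ) ⟩
      (𝒯 w (λ m ε → ι m *ℚ Z₁ m ε) n δ +ℚ 𝒯 w′ Z₁ n δ) +ℚ f *ℚ y
        ≡⟨ cong₂ (λ s t → (s +ℚ t) +ℚ f *ℚ y) inner (𝒯-Z w′ (suc p) n δ) ⟩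
      (((a +ℚ (-ℚ ι (suc p)) *ℚ b) +ℚ c) +ℚ (b +ℚ g *ℚ x)) +ℚ f *ℚ y
        -- Writing 1/p! as (p+1) · 1/(p+1)! turns the next step into a polynomial identity; it is
        -- folded back afterwards.
        ≡⟨ cong (λ f → (((a +ℚ (-ℚ ι (suc p)) *ℚ b) +ℚ c) +ℚ (b +ℚ g *ℚ x)) +ℚ f *ℚ y) (sym (ι*1/! p)) ⟩
      (((a +ℚ (-ℚ ι (suc p)) *ℚ b) +ℚ c) +ℚ (b +ℚ g *ℚ x)) +ℚ (ι (suc p) *ℚ g) *ℚ y
        ≡⟨ solve 7 (λ a b c x y q g →
             (((a :+ (:- (con 1ℚ :+ q)) :* b) :+ c) :+ (b :+ g :* x)) :+ ((con 1ℚ :+ q) :* g) :* y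
             := ((a :+ ((con 1ℚ :+ q) :* g) :* x) :+ (:- q) :* (b :+ g :* x)) :+ (c :+ ((con 1ℚ :+ q) :* g) :* y))
             refl a b c x y (ι p) g ⟩
      ((a +ℚ (ι (suc p) *ℚ g) *ℚ x) +ℚ (-ℚ ι p) *ℚ (b +ℚ g *ℚ x)) +ℚ (c +ℚ (ι (suc p) *ℚ g) *ℚ y)
        ≡⟨ cong (λ f → ((a +ℚ f *ℚ x) +ℚ (-ℚ ι p) *ℚ (b +ℚ g *ℚ x)) +ℚ (c +ℚ f *ℚ y)) (ι*1/! p) ⟩
      ((a +ℚ f *ℚ x) +ℚ (-ℚ ι p) *ℚ (b +ℚ g *ℚ x)) +ℚ (c +ℚ f *ℚ y)
        ≡⟨ cong₂ _+ℚ_ (cong₂ (λ s t → s +ℚ (-ℚ ι p) *ℚ t) (𝒯-Z w′ p n δ) (𝒯-Z w′ (suc p) n δ)) (𝒯-Z κ p n δ) ⟨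
      (𝒯 w′ (Z p) n δ +ℚ (-ℚ ι p) *ℚ 𝒯 w′ Z₁ n δ) +ℚ 𝒯 κ (Z p) n δ ∎
      where
      Z₁ = Z (suc p)
      Z₂ = Z (suc (suc p))
      f = 1/! p
      g = 1/! (suc p)
      a = 𝒯 w′ (𝒯 w Z₁) n δ
      b = 𝒯 w′ (𝒯 w Z₂) n δ
      c = 𝒯 κ (𝒯 w Z₁) n δ
      x = 𝒯 w′ B n δ
      y = 𝒯 κ B n δ
      inner : 𝒯 w (λ m ε → ι m *ℚ Z₁ m ε) n δ ≡ (a +ℚ (-ℚ ι (suc p)) *ℚ b) +ℚ c
      inner = begin
        𝒯 w (λ m ε → ι m *ℚ Z₁ m ε) n δ
          -- Only degrees below `n` occur under `𝒯 w`, so the hypothesis is available, at `suc p`.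
          ≡⟨ 𝒯-cong-< w w0 n (λ m<n → rec m<n (suc p)) δ ⟩
        𝒯 w (λ m ε → (𝒯 w′ Z₁ m ε +ℚ (-ℚ ι (suc p)) *ℚ 𝒯 w′ Z₂ m ε) +ℚ 𝒯 κ Z₁ m ε) n δ
          ≡⟨ 𝒯-+ w (λ m ε → 𝒯 w′ Z₁ m ε +ℚ (-ℚ ι (suc p)) *ℚ 𝒯 w′ Z₂ m ε) (𝒯 κ Z₁) n δ ⟩
        𝒯 w (λ m ε → 𝒯 w′ Z₁ m ε +ℚ (-ℚ ι (suc p)) *ℚ 𝒯 w′ Z₂ m ε) n δ +ℚ 𝒯 w (𝒯 κ Z₁) n δ
          ≡⟨ cong₂ _+ℚ_ (trans (𝒯-+ w (𝒯 w′ Z₁) _ n δ) (cong₂ _+ℚ_ (𝒯-comm w w′ Z₁ n δ)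
               (trans (𝒯-* w (-ℚ ι (suc p)) (𝒯 w′ Z₂) n δ) (cong ((-ℚ ι (suc p)) *ℚ_) (𝒯-comm w w′ Z₂ n δ))))) (𝒯-comm w κ Z₁ n δ) ⟩
        (a +ℚ (-ℚ ι (suc p)) *ℚ b) +ℚ c ∎

  -- Logarithmic derivatives add: the exponential contributes k w_k and `B` contributes κ_k.
  exp-Newton : Newton (λ k → ι k *ℚ w k +ℚ κ k) (Z 0)
  exp-Newton n δ = begin
    ι n *ℚ Z 0 n δ
      ≡⟨ <-rec Z-Newton Z-newton-step n 0 δ ⟩
    (𝒯 w′ (Z 0) n δ +ℚ (-ℚ 0ℚ) *ℚ 𝒯 w′ (Z 1) n δ) +ℚ 𝒯 κ (Z 0) n δ
      ≡⟨ solve 3 (λ x y z → (x :+ (:- con 0ℚ) :* y) :+ z := x :+ z) refl (𝒯 w′ (Z 0) n δ) (𝒯 w′ (Z 1) n δ) (𝒯 κ (Z 0) n δ) ⟩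
    𝒯 w′ (Z 0) n δ +ℚ 𝒯 κ (Z 0) n δ
      ≡⟨ 𝒯-weight-+ w′ κ (Z 0) n δ ⟨
    𝒯 (λ k → w′ k +ℚ κ k) (Z 0) n δ ∎

-- Expansion of h_n in power sums

∑-sub-splits : ∀ k d (G : ℕ × ℕ → ℚ) → ∑ (sub k d) (λ j → ∑ (splits j) G) ≡ ∑ (splits d) (λ s → ∑ (sub k (proj₁ s)) (λ i → G (i , proj₂ s)))
∑-sub-splits zero    d       G = trans (∑-[-] _ _) (∑-cong (splits d) (λ s → sym (∑-[-] _ _)))
∑-sub-splits (suc k) zero    G = trans (∑-[] _) (sym (trans (∑-[-] _ _) (∑-[] _)))
∑-sub-splits (suc k) (suc d) G = begin
  ∑ (sub k d) (λ j → ∑ (splits j) G)                                   ≡⟨ ∑-sub-splits k d G ⟩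
  r                                                                    ≡⟨ ℚₚ.+-identityˡ r ⟨
  0ℚ +ℚ r                                                              ≡⟨ cong (_+ℚ r) (∑-[] _) ⟨
  ∑ (sub (suc k) 0) (λ i → G (i , suc d)) +ℚ r                         ≡⟨ ∑-splits-suc d _ ⟨
  ∑ (splits (suc d)) (λ s → ∑ (sub (suc k) (proj₁ s)) (λ i → G (i , proj₂ s))) ∎
  where r = ∑ (splits d) (λ s → ∑ (sub k (proj₁ s)) (λ i → G (i , proj₂ s)))

-- The index form of M_(k) (g f) = (M_(k) g) f: lowering δ and then splitting it is the same as
-- splitting δ and lowering the first piece.
∑-lower-decomps : ∀ k δ (F : List ℕ × List ℕ → ℚ) →
  ∑ (lower k δ) (λ ε → ∑ (decomps ε) F) ≡ ∑ (decomps δ) (λ q → ∑ (lower k (proj₁ q)) (λ a → F (a , proj₂ q)))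
∑-lower-decomps k []      F = trans (∑-[] _) (sym (trans (∑-[-] _ _) (∑-[] _)))
∑-lower-decomps k (d ∷ δ) F = begin
  ∑ (lower k (d ∷ δ)) (λ ε → ∑ (decomps ε) F)
    ≡⟨ ∑-lower-∷ k d δ _ ⟩
  ∑ (sub k d) (λ j → ∑ (decomps (j ∷ δ)) F) +ℚ ∑ (lower k δ) (λ ε → ∑ (decomps (d ∷ ε)) F)
    ≡⟨ cong₂ _+ℚ_ (∑-cong (sub k d) (λ j → ∑-decomps-∷ j δ F)) (trans (∑-cong (lower k δ) (λ ε → ∑-decomps-∷ d ε F)) (∑-swap (lower k δ) (splits d) _)) ⟩
  ∑ (sub k d) (λ j → ∑ (splits j) (λ s → ∑ (decomps δ) (λ q → F (proj₁ s ∷ proj₁ q , proj₂ s ∷ proj₂ q))))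
  +ℚ ∑ (splits d) (λ s → ∑ (lower k δ) (λ ε → ∑ (decomps ε) (λ q → F (proj₁ s ∷ proj₁ q , proj₂ s ∷ proj₂ q))))
    ≡⟨ cong₂ _+ℚ_ (trans (∑-sub-splits k d _) (∑-cong (splits d) (λ s → ∑-swap (sub k (proj₁ s)) (decomps δ) _)))
                  (∑-cong (splits d) (λ s → ∑-lower-decomps k δ (λ q → F (proj₁ s ∷ proj₁ q , proj₂ s ∷ proj₂ q)))) ⟩
  ∑ (splits d) (λ s → ∑ (decomps δ) (λ q → ∑ (sub k (proj₁ s)) (λ i → F (i ∷ proj₁ q , proj₂ s ∷ proj₂ q))))
  +ℚ ∑ (splits d) (λ s → ∑ (decomps δ) (λ q → ∑ (lower k (proj₁ q)) (λ a → F (proj₁ s ∷ a , proj₂ s ∷ proj₂ q))))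
    ≡⟨ trans (∑-cong (splits d) (λ s → trans (∑-cong (decomps δ) (λ q → ∑-lower-∷ k (proj₁ s) (proj₁ q) _)) (∑-+ (decomps δ) _ _))) (∑-+ (splits d) _ _) ⟨
  ∑ (splits d) (λ s → ∑ (decomps δ) (λ q → ∑ (lower k (proj₁ s ∷ proj₁ q)) (λ a → F (a , proj₂ s ∷ proj₂ q))))
    ≡⟨ ∑-decomps-∷ d δ _ ⟨
  ∑ (decomps (d ∷ δ)) (λ q → ∑ (lower k (proj₁ q)) (λ a → F (a , proj₂ q))) ∎

-- The weight 0 at k = 0 and 1 elsewhere, written as a product so that it agrees with the weights
-- `ι k *ℚ w k` of an exponential.
κ₁ : ℕ → ℚ
κ₁ k = ι k *ℚ inv k

κ₁-suc : ∀ k → κ₁ (suc k) ≡ 1ℚ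
κ₁-suc k = ι*1/ (suc k)

sub-sum : ∀ k d → All (λ j → k + j ≡ d) (sub k d)
sub-sum zero    d       = refl ∷ []
sub-sum (suc k) zero    = []
sub-sum (suc k) (suc d) = All.map (cong suc) (sub-sum k d)

lower-sum : ∀ k δ → All (λ ε → k + sum ε ≡ sum δ) (lower k δ)
lower-sum k []      = []
lower-sum k (d ∷ δ) = Allₚ.++⁺
  (Allₚ.map⁺ (All.map (λ {j} e → trans (sym (ℕₚ.+-assoc k j (sum δ))) (cong (λ z → z + sum δ) e)) (sub-sum k d)))
  (Allₚ.map⁺ (All.map (λ {ε} e → trans (sym (ℕₚ.+-assoc k d (sum ε))) (trans (cong (λ z → z + sum ε) (ℕₚ.+-comm k d))
    (trans (ℕₚ.+-assoc d k (sum ε)) (cong (λ z → d + z) e)))) (lower-sum k δ)))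

∑-subs : ∀ n d → d ≤ n → ∑ (splits n) (λ p → ∑ (sub (proj₁ p) d) (λ _ → 1ℚ)) ≡ ι (suc d)
∑-subs zero    zero    _         = trans (∑-[-] _ _) (∑-[-] _ _)
∑-subs (suc n) d       d≤        = trans (∑-splits-suc n _) (cong₂ _+ℚ_ (∑-[-] _ _) (rest d d≤))
  where
  rest : ∀ d → d ≤ suc n → ∑ (splits n) (λ p → ∑ (sub (suc (proj₁ p)) d) (λ _ → 1ℚ)) ≡ ι d
  rest zero    _         = ∑-zero (splits n) (λ p → ∑-[] _)
  rest (suc d) (s≤s d≤n) = ∑-subs n d d≤n

-- Counts the k with 1 ≤ k ≤ d, that is, the positive powers of a variable x dividing x^d; `d ≤ n`
-- ensures that all of them occur in `splits n`.
∑-κ₁-subs : ∀ n d → d ≤ n → ∑ (splits n) (λ p → κ₁ (proj₁ p) *ℚ ∑ (sub (proj₁ p) d) (λ _ → 1ℚ)) ≡ ι d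
∑-κ₁-subs zero    zero    _         = trans (∑-[-] _ _) (ℚₚ.*-zeroˡ (∑ (sub 0 0) (λ _ → 1ℚ)))
∑-κ₁-subs (suc n) d       d≤        = begin
  ∑ (splits (suc n)) (λ p → κ₁ (proj₁ p) *ℚ ∑ (sub (proj₁ p) d) (λ _ → 1ℚ))
    ≡⟨ ∑-splits-suc n _ ⟩
  0ℚ *ℚ ∑ (sub 0 d) (λ _ → 1ℚ) +ℚ ∑ (splits n) (λ p → κ₁ (suc (proj₁ p)) *ℚ s (suc (proj₁ p)) d)
    ≡⟨ cong₂ _+ℚ_ (ℚₚ.*-zeroˡ (∑ (sub 0 d) (λ _ → 1ℚ))) (∑-cong (splits n) (λ p → trans (cong (_*ℚ s (suc (proj₁ p)) d) (κ₁-suc (proj₁ p))) (ℚₚ.*-identityˡ (s (suc (proj₁ p)) d)))) ⟩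
  0ℚ +ℚ ∑ (splits n) (λ p → s (suc (proj₁ p)) d)
    ≡⟨ trans (ℚₚ.+-identityˡ (∑ (splits n) (λ p → s (suc (proj₁ p)) d))) (rest d d≤) ⟩
  ι d ∎
  where
  s : ℕ → ℕ → ℚ
  s k d = ∑ (sub k d) (λ _ → 1ℚ)
  rest : ∀ d → d ≤ suc n → ∑ (splits n) (λ p → s (suc (proj₁ p)) d) ≡ ι d
  rest zero    _         = ∑-zero (splits n) (λ p → ∑-[] _)
  rest (suc d) (s≤s d≤n) = ∑-subs n d d≤n

∑-κ₁-lower : ∀ n a → sum a ≤ n → ∑ (splits n) (λ p → κ₁ (proj₁ p) *ℚ ∑ (lower (proj₁ p) a) (λ _ → 1ℚ)) ≡ ι (sum a)
∑-κ₁-lower n []      _ = ∑-zero (splits n) (λ p → trans (cong (κ₁ (proj₁ p) *ℚ_) (∑-[] _)) (ℚₚ.*-zeroʳ (κ₁ (proj₁ p))))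
∑-κ₁-lower n (d ∷ a) h = begin
  ∑ (splits n) (λ p → κ₁ (proj₁ p) *ℚ ∑ (lower (proj₁ p) (d ∷ a)) (λ _ → 1ℚ))
    ≡⟨ ∑-cong (splits n) (λ p → trans (cong (κ₁ (proj₁ p) *ℚ_) (∑-lower-∷ (proj₁ p) d a _))
         (ℚₚ.*-distribˡ-+ (κ₁ (proj₁ p)) (∑ (sub (proj₁ p) d) (λ _ → 1ℚ)) (∑ (lower (proj₁ p) a) (λ _ → 1ℚ)))) ⟩
  _ ≡⟨ ∑-+ (splits n) _ _ ⟩
  _ ≡⟨ cong₂ _+ℚ_ (∑-κ₁-subs n d (ℕₚ.≤-trans (ℕₚ.m≤m+n d (sum a)) h)) (∑-κ₁-lower n a (ℕₚ.≤-trans (ℕₚ.m≤n+m (sum a) d) h)) ⟩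
  ι d +ℚ ι (sum a) ≡⟨ ι-+ d (sum a) ⟨
  ι (d + sum a) ∎

≡ᵇ-true : ∀ {m n} → (m ≡ᵇ n) ≡ true → m ≡ n
≡ᵇ-true {m} {n} e = ℕₚ.≡ᵇ⇒≡ m n (subst T (sym e) _)

-- Newton's identity at the single monomial x^a: lowering by k lands in degree n - k exactly when
-- x^a has degree n, and then there are n ways to lower by a positive k.
∑-κ₁-homogeneous : ∀ n a → ∑ (splits n) (λ p → κ₁ (proj₁ p) *ℚ ∑ (lower (proj₁ p) a) (λ c → ⟦ sum c ≡ᵇ proj₂ p ⟧)) ≡ ι n *ℚ ⟦ sum a ≡ᵇ n ⟧
∑-κ₁-homogeneous n a = begin
  ∑ (splits n) (λ p → κ₁ (proj₁ p) *ℚ ∑ (lower (proj₁ p) a) (λ c → ⟦ sum c ≡ᵇ proj₂ p ⟧))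
    ≡⟨ ∑-cong-All (splits-sum n) (λ {p} e → trans (cong (κ₁ (proj₁ p) *ℚ_) (trans (∑-cong-All (lower-sum (proj₁ p) a) (λ {c} e′ →
         trans (cong ⟦_⟧ (trans (sym (≡ᵇ-cancelˡ (proj₁ p) (sum c) (proj₂ p))) (cong₂ _≡ᵇ_ e′ e))) (sym (ℚₚ.*-identityˡ ⟦ sum a ≡ᵇ n ⟧))))
         (∑-*ʳ (lower (proj₁ p) a) ⟦ sum a ≡ᵇ n ⟧ (λ _ → 1ℚ))))
         (sym (ℚₚ.*-assoc (κ₁ (proj₁ p)) (∑ (lower (proj₁ p) a) (λ _ → 1ℚ)) ⟦ sum a ≡ᵇ n ⟧))) ⟩
  ∑ (splits n) (λ p → (κ₁ (proj₁ p) *ℚ ∑ (lower (proj₁ p) a) (λ _ → 1ℚ)) *ℚ ⟦ sum a ≡ᵇ n ⟧)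
    ≡⟨ ∑-*ʳ (splits n) ⟦ sum a ≡ᵇ n ⟧ _ ⟩
  ∑ (splits n) (λ p → κ₁ (proj₁ p) *ℚ ∑ (lower (proj₁ p) a) (λ _ → 1ℚ)) *ℚ ⟦ sum a ≡ᵇ n ⟧
    ≡⟨ degree ⟩
  ι n *ℚ ⟦ sum a ≡ᵇ n ⟧ ∎
  where
  s = ∑ (splits n) (λ p → κ₁ (proj₁ p) *ℚ ∑ (lower (proj₁ p) a) (λ _ → 1ℚ))
  degree : s *ℚ ⟦ sum a ≡ᵇ n ⟧ ≡ ι n *ℚ ⟦ sum a ≡ᵇ n ⟧
  degree with sum a ≡ᵇ n in e
  ... | true  = cong (_*ℚ 1ℚ) (trans (∑-κ₁-lower n a (ℕₚ.≤-reflexive (≡ᵇ-true e))) (cong ι (≡ᵇ-true {sum a} e)))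
  ... | false = trans (ℚₚ.*-zeroʳ s) (sym (ℚₚ.*-zeroʳ (ι n)))

h*-Newton : ∀ f → Newton κ₁ (h* f)
h*-Newton f n δ = sym (begin
  𝒯 κ₁ (h* f) n δ
    ≡⟨ ∑-cong (splits n) (λ p → trans (cong (κ₁ (proj₁ p) *ℚ_) (trans (∑-lower-decomps (proj₁ p) δ _)
         (∑-cong (decomps δ) (λ q → ∑-*ʳ (lower (proj₁ p) (proj₁ q)) (f (proj₂ q)) _))))
         (trans (sym (∑-*ˡ (decomps δ) (κ₁ (proj₁ p)) _)) (∑-cong (decomps δ) (λ q →
           sym (ℚₚ.*-assoc (κ₁ (proj₁ p)) (∑ (lower (proj₁ p) (proj₁ q)) (λ c → ⟦ sum c ≡ᵇ proj₂ p ⟧)) (f (proj₂ q))))))) ⟩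
  ∑ (splits n) (λ p → ∑ (decomps δ) (λ q → (κ₁ (proj₁ p) *ℚ ∑ (lower (proj₁ p) (proj₁ q)) (λ c → ⟦ sum c ≡ᵇ proj₂ p ⟧)) *ℚ f (proj₂ q)))
    ≡⟨ ∑-swap (splits n) (decomps δ) _ ⟩
  ∑ (decomps δ) (λ q → ∑ (splits n) (λ p → (κ₁ (proj₁ p) *ℚ ∑ (lower (proj₁ p) (proj₁ q)) (λ c → ⟦ sum c ≡ᵇ proj₂ p ⟧)) *ℚ f (proj₂ q)))
    ≡⟨ ∑-cong (decomps δ) (λ q → trans (∑-*ʳ (splits n) (f (proj₂ q)) _) (trans (cong (_*ℚ f (proj₂ q)) (∑-κ₁-homogeneous n (proj₁ q)))
         (ℚₚ.*-assoc (ι n) ⟦ sum (proj₁ q) ≡ᵇ n ⟧ (f (proj₂ q))))) ⟩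
  ∑ (decomps δ) (λ q → ι n *ℚ (⟦ sum (proj₁ q) ≡ᵇ n ⟧ *ℚ f (proj₂ q)))
    ≡⟨ ∑-*ˡ (decomps δ) (ι n) _ ⟩
  ι n *ℚ h* f n δ ∎)

-- Multiplication by p_a. The factor `f` is arbitrary because the later blocks of β will be put in
-- its place.
p* : Composition → (List ℕ → ℚ) → List ℕ → ℚ
p* []      f δ = f δ
p* (x ∷ a) f δ = inv x *ℚ ∑ (lower x δ) (p* a f)

-- Compositions with empty OtE and the two exponentials

noOtE : ℕ → List ℕ → Bool
noOtE x []      = true
noOtE x (y ∷ _) = not (isOdd x ∧ isEven y)

-- Tested on adjacent parts, since extending a block of β by one part yields exactly one factor
-- `noOtE`.
evensThenOdds : List ℕ → Bool
evensThenOdds []      = true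
evensThenOdds (x ∷ a) = noOtE x a ∧ evensThenOdds a

allOdd : List ℕ → Bool
allOdd []      = true
allOdd (x ∷ a) = isOdd x ∧ allOdd a

evensThenOdds-odd : ∀ x a → isOdd x ≡ true → evensThenOdds (x ∷ a) ≡ allOdd a
evensThenOdds-odd x []      e = refl
evensThenOdds-odd x (y ∷ a) e rewrite e with isOdd y in e′
... | true  = evensThenOdds-odd y a e′
... | false = refl

evensThenOdds-even : ∀ x a → isOdd x ≡ false → evensThenOdds (x ∷ a) ≡ evensThenOdds a
evensThenOdds-even x []      e = refl
evensThenOdds-even x (y ∷ a) e rewrite e = refl

allOdd⇒countEven : ∀ a → allOdd a ≡ true → countEven a ≡ 0
allOdd⇒countEven []      e = refl
allOdd⇒countEven (x ∷ a) e with isOdd x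
... | true = allOdd⇒countEven a e

module _ (f : List ℕ → ℚ) where

  powerSums : (List ℕ → ℚ) → Series
  powerSums u n δ = ∑ (compositions n) (λ a → u a *ℚ p* a f δ)

  private

    powerSums-cong : ∀ {u v} → u ≐ v → ∀ n δ → powerSums u n δ ≡ powerSums v n δ
    powerSums-cong e n δ = ∑-cong (compositions n) (λ a → cong (_*ℚ p* a f δ) (e a))

    powerSums-* : ∀ c u n δ → powerSums (λ a → c *ℚ u a) n δ ≡ c *ℚ powerSums u n δ
    powerSums-* c u n δ = trans (∑-cong (compositions n) (λ a → ℚₚ.*-assoc c (u a) (p* a f δ))) (∑-*ˡ (compositions n) c _)

    powerSums-suc : ∀ u n δ → powerSums u (suc n) δ
      ≡ ∑ (splits n) (λ p → inv (suc (proj₁ p)) *ℚ ∑ (lower (suc (proj₁ p)) δ) (powerSums (λ a → u (suc (proj₁ p) ∷ a)) (proj₂ p)))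
    powerSums-suc u n δ = trans (∑-compositions-suc n _) (∑-cong (splits n) (λ p → at (suc (proj₁ p)) (proj₂ p)))
      where
      at : ∀ k m → ∑ (compositions m) (λ a → u (k ∷ a) *ℚ (inv k *ℚ ∑ (lower k δ) (p* a f)))
        ≡ inv k *ℚ ∑ (lower k δ) (powerSums (λ a → u (k ∷ a)) m)
      at k m = begin
        ∑ (compositions m) (λ a → u (k ∷ a) *ℚ (inv k *ℚ ∑ (lower k δ) (p* a f)))
          ≡⟨ ∑-cong (compositions m) (λ a → trans
               (solve 3 (λ x y z → x :* (y :* z) := y :* (x :* z)) refl (u (k ∷ a)) (inv k) (∑ (lower k δ) (p* a f)))
               (cong (inv k *ℚ_) (sym (∑-*ˡ (lower k δ) (u (k ∷ a)) _)))) ⟩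
        ∑ (compositions m) (λ a → inv k *ℚ ∑ (lower k δ) (λ ε → u (k ∷ a) *ℚ p* a f ε))
          ≡⟨ ∑-*ˡ (compositions m) (inv k) _ ⟩
        inv k *ℚ ∑ (compositions m) (λ a → ∑ (lower k δ) (λ ε → u (k ∷ a) *ℚ p* a f ε))
          ≡⟨ cong (inv k *ℚ_) (∑-swap (compositions m) (lower k δ) _) ⟩
        inv k *ℚ ∑ (lower k δ) (powerSums (λ a → u (k ∷ a)) m) ∎

    wₒ wₑ : ℕ → ℚ
    wₒ k = if isOdd k then inv k else 0ℚ
    wₑ k = if isOdd k then 0ℚ else inv k

    one : Series
    one zero    δ = f δ
    one (suc n) δ = 0ℚ

    -- The shift `p` in one factorial makes `powerSums (u p)` and `powerSums (v p)` the families
    -- `Z p` of the two exponentials, odd parts for `u` and, applied on top of `u 0`, even parts for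
    -- `v`.
    u v : ℕ → List ℕ → ℚ
    u p a = ⟦ allOdd a ⟧ *ℚ 1/! (p + countOdd a)
    v p a = ⟦ evensThenOdds a ⟧ *ℚ (1/! (countOdd a) *ℚ 1/! (p + countEven a))

    u-odd : ∀ p x a → isOdd x ≡ true → u p (x ∷ a) ≡ u (suc p) a
    u-odd p x a e rewrite e = cong (λ z → ⟦ allOdd a ⟧ *ℚ 1/! z) (ℕₚ.+-suc p (countOdd a))

    -- The zero has the form `0ℚ *ℚ 1ℚ` to fit the scalar factor in `powerSums-*`.
    u-even : ∀ p x a → isOdd x ≡ false → u p (x ∷ a) ≡ 0ℚ *ℚ 1ℚ
    u-even p x a e rewrite e = trans (ℚₚ.*-zeroˡ (1/! (p + countOdd a))) (sym (ℚₚ.*-zeroˡ 1ℚ))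

    -- After a leading odd part no even part may follow, so the even count is 0 and its factorial
    -- reduces to the constant 1/p!.
    v-odd : ∀ p x a → isOdd x ≡ true → v p (x ∷ a) ≡ 1/! p *ℚ u 1 a
    v-odd p x a e rewrite evensThenOdds-odd x a e | e with allOdd a in o
    ... | true  rewrite allOdd⇒countEven a o | ℕₚ.+-identityʳ p =
      solve 2 (λ x y → con 1ℚ :* (x :* y) := y :* (con 1ℚ :* x)) refl (1/! (suc (countOdd a))) (1/! p)
    ... | false = trans (ℚₚ.*-zeroˡ (1/! (suc (countOdd a)) *ℚ 1/! (p + countEven a)))
      (solve 2 (λ x y → con 0ℚ := y :* (con 0ℚ :* x)) refl (1/! (suc (countOdd a))) (1/! p))

    v-even : ∀ p x a → isOdd x ≡ false → v p (x ∷ a) ≡ v (suc p) a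
    v-even p x a e rewrite evensThenOdds-even x a e | e =
      cong (λ z → ⟦ evensThenOdds a ⟧ *ℚ (1/! (countOdd a) *ℚ 1/! z)) (ℕₚ.+-suc p (countEven a))

    odd-step : ∀ p k m δ → inv k *ℚ ∑ (lower k δ) (powerSums (λ a → u p (k ∷ a)) m) ≡ wₒ k *ℚ ∑ (lower k δ) (powerSums (u (suc p)) m)
    odd-step p k m δ = by-parity (isOdd k) refl
      where
      by-parity : ∀ b → isOdd k ≡ b → inv k *ℚ ∑ (lower k δ) (powerSums (λ a → u p (k ∷ a)) m)
        ≡ (if b then inv k else 0ℚ) *ℚ ∑ (lower k δ) (powerSums (u (suc p)) m)
      by-parity true  e = cong (inv k *ℚ_) (∑-cong (lower k δ) (powerSums-cong (λ a → u-odd p k a e) m))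
      by-parity false e = trans
        (cong (inv k *ℚ_) (∑-zero (lower k δ) (λ ε → trans (powerSums-cong (λ a → u-even p k a e) m ε)
          (trans (powerSums-* 0ℚ (λ _ → 1ℚ) m ε) (ℚₚ.*-zeroˡ (powerSums (λ _ → 1ℚ) m ε))))))
        (trans (ℚₚ.*-zeroʳ (inv k)) (sym (ℚₚ.*-zeroˡ (∑ (lower k δ) (powerSums (u (suc p)) m)))))

    -- A leading even part belongs to the exponential in the even parts; a leading odd part means
    -- that this exponential has contributed its constant term 1/p! and the one in the odd parts has
    -- begun.
    even-step : ∀ p k m δ → inv k *ℚ ∑ (lower k δ) (powerSums (λ a → v p (k ∷ a)) m)
      ≡ wₑ k *ℚ ∑ (lower k δ) (powerSums (v (suc p)) m) +ℚ 1/! p *ℚ (wₒ k *ℚ ∑ (lower k δ) (powerSums (u 1) m))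
    even-step p k m δ = by-parity (isOdd k) refl
      where
      s = ∑ (lower k δ) (powerSums (u 1) m)
      t = ∑ (lower k δ) (powerSums (v (suc p)) m)
      by-parity : ∀ b → isOdd k ≡ b → inv k *ℚ ∑ (lower k δ) (powerSums (λ a → v p (k ∷ a)) m)
        ≡ (if b then 0ℚ else inv k) *ℚ t +ℚ 1/! p *ℚ ((if b then inv k else 0ℚ) *ℚ s)
      by-parity true  e = begin
        inv k *ℚ ∑ (lower k δ) (powerSums (λ a → v p (k ∷ a)) m)
          ≡⟨ cong (inv k *ℚ_) (trans (∑-cong (lower k δ) (λ ε → trans (powerSums-cong (λ a → v-odd p k a e) m ε) (powerSums-* (1/! p) (u 1) m ε)))
               (∑-*ˡ (lower k δ) (1/! p) (powerSums (u 1) m))) ⟩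
        inv k *ℚ (1/! p *ℚ s)
          ≡⟨ solve 4 (λ i q s t → i :* (q :* s) := con 0ℚ :* t :+ q :* (i :* s)) refl (inv k) (1/! p) s t ⟩
        0ℚ *ℚ t +ℚ 1/! p *ℚ (inv k *ℚ s) ∎
      by-parity false e = trans (cong (inv k *ℚ_) (∑-cong (lower k δ) (powerSums-cong (λ a → v-even p k a e) m)))
        (solve 3 (λ x q s → x := x :+ q :* (con 0ℚ :* s)) refl (inv k *ℚ t) (1/! p) s)

    odd-rec : ∀ p n δ → powerSums (u p) n δ ≡ 𝒯 wₒ (powerSums (u (suc p))) n δ +ℚ 1/! p *ℚ one n δ
    odd-rec p zero    δ rewrite 𝒯-at-zero {wₒ} refl (powerSums (u (suc p))) δ = trans (∑-[-] _ _)
      (trans (cong (λ z → (1ℚ *ℚ 1/! z) *ℚ f δ) (ℕₚ.+-identityʳ p)) (solve 2 (λ q x → (con 1ℚ :* q) :* x := con 0ℚ :+ q :* x) refl (1/! p) (f δ)))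
    odd-rec p (suc n) δ = begin
      powerSums (u p) (suc n) δ
        ≡⟨ trans (powerSums-suc (u p) n δ) (∑-cong (splits n) (λ s → odd-step p (suc (proj₁ s)) (proj₂ s) δ)) ⟩
      _ ≡⟨ 𝒯-suc {wₒ} refl (powerSums (u (suc p))) n δ ⟨
      t ≡⟨ solve 2 (λ t q → t := t :+ q :* con 0ℚ) refl t (1/! p) ⟩
      t +ℚ 1/! p *ℚ 0ℚ ∎
      where t = 𝒯 wₒ (powerSums (u (suc p))) (suc n) δ

    odd-Newton : Newton (λ k → ι k *ℚ wₒ k +ℚ 0ℚ) (powerSums (u 0))
    odd-Newton = exp-Newton wₒ (λ _ → 0ℚ) one (λ p → powerSums (u p)) refl one-Newton odd-rec
      where
      one-Newton : Newton (λ _ → 0ℚ) one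
      one-Newton zero    δ = trans (ℚₚ.*-zeroˡ (f δ)) (sym (𝒯-weight-zero one 0 δ))
      one-Newton (suc n) δ = trans (ℚₚ.*-zeroʳ (ι (suc n))) (sym (𝒯-weight-zero one (suc n) δ))

    even-rec : ∀ p n δ → powerSums (v p) n δ ≡ 𝒯 wₑ (powerSums (v (suc p))) n δ +ℚ 1/! p *ℚ powerSums (u 0) n δ
    even-rec p zero    δ rewrite 𝒯-at-zero {wₑ} refl (powerSums (v (suc p))) δ | ∑-[-] [] (λ a → u 0 a *ℚ p* a f δ) = trans (∑-[-] _ _)
      (trans (cong (λ z → (1ℚ *ℚ (1/! 0 *ℚ 1/! z)) *ℚ f δ) (ℕₚ.+-identityʳ p))
        (solve 3 (λ o q x → (con 1ℚ :* (o :* q)) :* x := con 0ℚ :+ q :* ((con 1ℚ :* o) :* x)) refl (1/! 0) (1/! p) (f δ)))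
    even-rec p (suc n) δ = begin
      powerSums (v p) (suc n) δ
        ≡⟨ trans (powerSums-suc (v p) n δ) (∑-cong (splits n) (λ s → even-step p (suc (proj₁ s)) (proj₂ s) δ)) ⟩
      _ ≡⟨ trans (∑-+ (splits n) _ _) (cong (∑ (splits n) _ +ℚ_) (∑-*ˡ (splits n) (1/! p) _)) ⟩
      _ ≡⟨ cong₂ (λ x y → x +ℚ 1/! p *ℚ y) (𝒯-suc {wₑ} refl (powerSums (v (suc p))) n δ) (𝒯-suc {wₒ} refl (powerSums (u 1)) n δ) ⟨
      t +ℚ 1/! p *ℚ 𝒯 wₒ (powerSums (u 1)) (suc n) δ
        -- In positive degree `one` vanishes, so `odd-rec 0` identifies the sum over leading odd
        -- parts with `powerSums (u 0)`.
        ≡⟨ cong (λ x → t +ℚ 1/! p *ℚ x) (trans (odd-rec 0 (suc n) δ) (ℚₚ.+-identityʳ (𝒯 wₒ (powerSums (u 1)) (suc n) δ))) ⟨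
      t +ℚ 1/! p *ℚ powerSums (u 0) (suc n) δ ∎
      where t = 𝒯 wₑ (powerSums (v (suc p))) (suc n) δ

    -- Each k has exactly one parity, so the logarithmic derivatives of the two exponentials add up
    -- to that of ∑ h_n.
    blocks-Newton : Newton κ₁ (powerSums (v 0))
    blocks-Newton n δ = trans
      (exp-Newton wₑ (λ k → ι k *ℚ wₒ k +ℚ 0ℚ) (powerSums (u 0)) (λ p → powerSums (v p)) refl odd-Newton even-rec n δ)
      (𝒯-weight-cong weights (powerSums (v 0)) n δ)
      where
      weights : ∀ k → ι k *ℚ wₑ k +ℚ (ι k *ℚ wₒ k +ℚ 0ℚ) ≡ κ₁ k
      weights k with isOdd k
      ... | true  = solve 2 (λ k i → k :* con 0ℚ :+ (k :* i :+ con 0ℚ) := k :* i) refl (ι k) (inv k)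
      ... | false = solve 2 (λ k i → k :* i :+ (k :* con 0ℚ :+ con 0ℚ) := k :* i) refl (ι k) (inv k)

  h*-powerSums : ∀ n δ → h* f n δ ≡ powerSums (λ a → ⟦ evensThenOdds a ⟧ *ℚ blockCoeff a) n δ
  h*-powerSums n δ = trans (Newton-unique {κ₁} refl (h*-Newton f) blocks-Newton at-zero n δ)
    (powerSums-cong (λ a → cong (⟦ evensThenOdds a ⟧ *ℚ_) (sym (blockCoeff-1/! a))) n δ)
    where
    at-zero : h* f 0 ≐ powerSums (v 0) 0
    at-zero δ = trans (h*-zero f δ) (sym (trans (∑-[-] _ _) (ℚₚ.*-identityˡ (f δ))))

-- The interval m_o(γ) ≤ β ≤ γ

interval : Composition → Composition → Bool
interval γ β = mo γ ≤ᶜ β ∧ β ≤ᶜ γ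

subset : List ℕ → List ℕ → Bool
subset xs ys = all (λ s → memb s ys) xs

shift : ℕ → List ℕ → List ℕ
shift a = map (λ s → a + s)

memb-shift : ∀ a s ys → memb (a + s) (shift a ys) ≡ memb s ys
memb-shift a s []       = refl
memb-shift a s (y ∷ ys) = cong₂ _∨_ (≡ᵇ-cancelˡ a s y) (memb-shift a s ys)

≡ᵇ-refl : ∀ a → (a ≡ᵇ a) ≡ true
≡ᵇ-refl zero    = refl
≡ᵇ-refl (suc a) = ≡ᵇ-refl a

a+1+s≢a : ∀ a s → (a + suc s ≡ᵇ a) ≡ false
a+1+s≢a zero    s = refl
a+1+s≢a (suc a) s = a+1+s≢a a s

memb-self-shift : ∀ a {ys} → IsComposition ys → memb a (shift a ys) ≡ false
memb-self-shift a []                      = refl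
memb-self-shift a (_∷_ {suc y} (s≤s _) p) = cong₂ _∨_ (trans (≡ᵇ-comm a (a + suc y)) (a+1+s≢a a y)) (memb-self-shift a p)

subset-shift : ∀ a xs ys → subset (shift a xs) (shift a ys) ≡ subset xs ys
subset-shift a []       ys = refl
subset-shift a (x ∷ xs) ys = cong₂ _∧_ (memb-shift a x ys) (subset-shift a xs ys)

subset-shift-∷ : ∀ a {xs} ys → IsComposition xs → subset (shift a xs) (a ∷ shift a ys) ≡ subset xs ys
subset-shift-∷ a ys []                      = refl
subset-shift-∷ a ys (_∷_ {suc x} (s≤s _) p) = cong₂ _∧_ (cong₂ _∨_ (a+1+s≢a a x) (memb-shift a (suc x) ys)) (subset-shift-∷ a ys p)

subset-∷-shift-∷ : ∀ a {xs} ys → IsComposition xs → subset (a ∷ shift a xs) (a ∷ shift a ys) ≡ subset xs ys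
subset-∷-shift-∷ a ys p = cong₂ _∧_ (cong (_∨ memb a (shift a ys)) (≡ᵇ-refl a)) (subset-shift-∷ a ys p)

partialSums-positive : ∀ {γ} → IsComposition γ → IsComposition (partialSums γ)
partialSums-positive []            = []
partialSums-positive (p ∷ [])      = []
partialSums-positive (p ∷ q ∷ ps)  = p ∷ Allₚ.map⁺ (All.map (λ _ → ℕₚ.≤-trans p (ℕₚ.m≤m+n _ _)) (partialSums-positive (q ∷ ps)))

partialSums-+ : ∀ x y β → partialSums ((x + y) ∷ β) ≡ shift x (partialSums (y ∷ β))
partialSums-+ x y []      = refl
partialSums-+ x y (b ∷ β) = cong ((x + y) ∷_) (trans (Listₚ.map-cong (ℕₚ.+-assoc x y) (partialSums (b ∷ β))) (Listₚ.map-∘ (partialSums (b ∷ β))))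

moStep-positive : ∀ {a} r {rest} → 1 ≤ a → IsComposition rest → IsComposition (moStep a r rest)
moStep-positive []      pa pr = pa ∷ []
moStep-positive {a} (b ∷ _) pa pr with isOdd a ∧ isEven b
moStep-positive (b ∷ _) pa pr        | true  = pa ∷ pr
moStep-positive (b ∷ _) pa []        | false = pa ∷ []
moStep-positive (b ∷ _) pa (pm ∷ pr) | false = ℕₚ.≤-trans pa (ℕₚ.m≤m+n _ _) ∷ pr

mo-positive : ∀ {γ} → IsComposition γ → IsComposition (mo γ)
mo-positive []                 = []
mo-positive {_ ∷ r} (pa ∷ pr)  = moStep-positive r pa (mo-positive pr)

mo-∷ : ∀ y γ → ∃ λ m → ∃ λ ms → mo (y ∷ γ) ≡ m ∷ ms
mo-∷ y []      = y , [] , refl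
mo-∷ y (z ∷ γ) with isOdd y ∧ isEven z
... | true  = y , mo (z ∷ γ) , refl
... | false with mo (z ∷ γ)
...   | []     = y , [] , refl
...   | m ∷ ms = y + m , ms , refl

sum-positive : ∀ {x γ} → IsComposition (x ∷ γ) → sum (x ∷ γ) ≢ 0
sum-positive (s≤s _ ∷ _) ()

-- Both compositions cut after `x`, so a cut of m_o there is harmless. The equal sums exclude that
-- only one of the tails is empty.
interval-eq : ∀ x {γ β} → IsComposition γ → IsComposition β → sum γ ≡ sum β → interval (x ∷ γ) (x ∷ β) ≡ interval γ β
interval-eq x {[]}    {[]}    pγ pβ e = refl
interval-eq x {[]}    {b ∷ β} pγ pβ e = ⊥-elim (sum-positive pβ (sym e))
interval-eq x {y ∷ γ} {[]}    pγ pβ e = ⊥-elim (sum-positive pγ e)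
interval-eq x {y ∷ γ} {b ∷ β} pγ pβ e = cong₂ _∧_ coarse (subset-∷-shift-∷ x (partialSums (y ∷ γ)) (partialSums-positive pβ))
  where
  coarse : mo (x ∷ y ∷ γ) ≤ᶜ (x ∷ b ∷ β) ≡ mo (y ∷ γ) ≤ᶜ (b ∷ β)
  coarse with mo (y ∷ γ) | mo-∷ y γ | mo-positive pγ
  ... | _ | m , ms , refl | pm with isOdd x ∧ isEven y
  ...   | true  = subset-∷-shift-∷ x (partialSums (b ∷ β)) (partialSums-positive pm)
  ...   | false = trans (cong (λ P → subset P (partialSums (x ∷ b ∷ β))) (partialSums-+ x m ms)) (subset-shift-∷ x (partialSums (b ∷ β)) (partialSums-positive pm))

-- The coarser composition runs on past `x`, so m_o must not cut there: this is the factor `noOtE`.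
-- All other partial sums are translates by `x`.
interval-lt : ∀ x k {y γ β} → IsComposition β →
  interval (x ∷ y ∷ γ) ((x + suc k) ∷ β) ≡ noOtE x (y ∷ γ) ∧ interval (y ∷ γ) (suc k ∷ β)
interval-lt x k {y} {γ} {β} pβ = trans (cong₂ _∧_ coarse fine) (Boolₚ.∧-assoc (noOtE x (y ∷ γ)) _ _)
  where
  pkβ : IsComposition (partialSums (suc k ∷ β))
  pkβ = partialSums-positive (s≤s z≤n ∷ pβ)
  fine : ((x + suc k) ∷ β) ≤ᶜ (x ∷ y ∷ γ) ≡ (suc k ∷ β) ≤ᶜ (y ∷ γ)
  fine = trans (cong (λ P → subset P (partialSums (x ∷ y ∷ γ))) (partialSums-+ x (suc k) β)) (subset-shift-∷ x (partialSums (y ∷ γ)) pkβ)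
  coarse : mo (x ∷ y ∷ γ) ≤ᶜ ((x + suc k) ∷ β) ≡ noOtE x (y ∷ γ) ∧ mo (y ∷ γ) ≤ᶜ (suc k ∷ β)
  coarse rewrite partialSums-+ x (suc k) β with mo (y ∷ γ) | mo-∷ y γ
  ... | _ | m , ms , refl with isOdd x ∧ isEven y
  ...   | true  = break-inside
    where
    break-inside : subset (x ∷ shift x (partialSums (m ∷ ms))) (shift x (partialSums (suc k ∷ β))) ≡ false
    break-inside = cong (_∧ subset (shift x (partialSums (m ∷ ms))) (shift x (partialSums (suc k ∷ β)))) (memb-self-shift x pkβ)
  ...   | false = trans (cong (λ P → subset P (shift x (partialSums (suc k ∷ β)))) (partialSums-+ x m ms)) (subset-shift x (partialSums (m ∷ ms)) (partialSums (suc k ∷ β)))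

-- The cut after `b` falls strictly inside a part of the finer composition. The further part `c` is
-- what makes `b` a partial sum and not the total.
interval-gt : ∀ b k {γ c β} → IsComposition γ → interval ((b + suc k) ∷ γ) (b ∷ c ∷ β) ≡ false
interval-gt b k {γ} {c} {β} pγ = trans (cong (mo ((b + suc k) ∷ γ) ≤ᶜ (b ∷ c ∷ β) ∧_) fine) (Boolₚ.∧-zeroʳ _)
  where
  fine : (b ∷ c ∷ β) ≤ᶜ ((b + suc k) ∷ γ) ≡ false
  fine rewrite partialSums-+ b (suc k) γ =
    cong (_∧ subset (shift b (partialSums (c ∷ β))) (shift b (partialSums (suc k ∷ γ)))) (memb-self-shift b (partialSums-positive (s≤s z≤n ∷ pγ)))

-- Cutting off the first block

takeUpTo-∷ : ∀ t x xs → takeUpTo (suc t) (x ∷ xs) ≡ (x ∷ proj₁ (takeUpTo (suc t ∸ x) xs) , proj₂ (takeUpTo (suc t ∸ x) xs))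
takeUpTo-∷ t x xs with takeUpTo (suc t ∸ x) xs
... | _ , _ = refl

takeUpTo-++ : ∀ t xs → proj₁ (takeUpTo t xs) ++ proj₂ (takeUpTo t xs) ≡ xs
takeUpTo-++ zero    xs       = refl
takeUpTo-++ (suc t) []       = refl
takeUpTo-++ (suc t) (x ∷ xs) rewrite takeUpTo-∷ t x xs = cong (x ∷_) (takeUpTo-++ (suc t ∸ x) xs)

∑-splits-truncate : ∀ b m (G : ℕ × ℕ → ℚ) → (∀ i j → i + j ≡ b + m → b < i → G (i , j) ≡ 0ℚ) →
  ∑ (splits (b + m)) G ≡ ∑ (splits b) (λ s → G (proj₁ s , proj₂ s + m))
∑-splits-truncate zero    zero    G z = trans (∑-[-] _ G) (sym (∑-[-] _ _))
∑-splits-truncate zero    (suc m) G z = begin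
  ∑ (splits (suc m)) G
    ≡⟨ ∑-splits-suc m G ⟩
  G (0 , suc m) +ℚ ∑ (splits m) (λ s → G (suc (proj₁ s) , proj₂ s))
    ≡⟨ cong (G (0 , suc m) +ℚ_) (trans (∑-cong-All (splits-sum m) (λ {s} e → z (suc (proj₁ s)) (proj₂ s) (cong suc e) (s≤s z≤n))) (∑-zero (splits m) (λ _ → refl))) ⟩
  G (0 , suc m) +ℚ 0ℚ
    ≡⟨ trans (ℚₚ.+-identityʳ (G (0 , suc m))) (sym (∑-[-] _ _)) ⟩
  ∑ (splits 0) (λ s → G (proj₁ s , proj₂ s + suc m)) ∎
∑-splits-truncate (suc b) m       G z = begin
  ∑ (splits (suc (b + m))) G
    ≡⟨ ∑-splits-suc (b + m) G ⟩
  G (0 , suc (b + m)) +ℚ ∑ (splits (b + m)) (λ s → G (suc (proj₁ s) , proj₂ s))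
    ≡⟨ cong (G (0 , suc (b + m)) +ℚ_) (∑-splits-truncate b m (λ s → G (suc (proj₁ s) , proj₂ s)) (λ i j e l → z (suc i) j (cong suc e) (s≤s l))) ⟩
  G (0 , suc (b + m)) +ℚ ∑ (splits b) (λ s → G (suc (proj₁ s) , proj₂ s + m))
    ≡⟨ ∑-splits-suc b _ ⟨
  ∑ (splits (suc b)) (λ s → G (proj₁ s , proj₂ s + m)) ∎

-- Cutting γ after its initial block of sum suc b makes the interval condition multiplicative.
IntervalSplit : Composition → ℕ → Set
IntervalSplit β b = ∀ (Ψ : List ℕ × List ℕ → ℚ) →
  ∑ (compositions (suc b + sum β)) (λ γ → ⟦ interval γ (suc b ∷ β) ⟧ *ℚ Ψ (takeUpTo (suc b) γ))
  ≡ ∑ (compositions (suc b)) (λ a → ⟦ evensThenOdds a ⟧ *ℚ ∑ (compositions (sum β)) (λ c → ⟦ interval c β ⟧ *ℚ Ψ (a , c)))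

-- Strong induction through the first part of γ. If it exceeds the block, the interval is missed; if
-- it fills the block, the block closes; if it is shorter, a smaller block remains, and the part
-- together with its test `noOtE` is absorbed into `Ψ`. This is why `Ψ` is quantified inside the
-- induction.
interval-split : ∀ {β} → IsComposition β → ∀ b → IntervalSplit β b
interval-split {β} pβ = <-rec (IntervalSplit β) step
  where
  m = sum β
  step : ∀ b → (∀ {j} → j < b → IntervalSplit β j) → IntervalSplit β b
  step b rec Ψ = begin
    ∑ (compositions (suc b + m)) F
      ≡⟨ ∑-compositions-suc (b + m) F ⟩
    ∑ (splits (b + m)) (λ s → ∑ (compositions (proj₂ s)) (λ γ → F (suc (proj₁ s) ∷ γ)))
      ≡⟨ ∑-splits-truncate b m _ too-long ⟩
    ∑ (splits b) (λ s → ∑ (compositions (proj₂ s + m)) (λ γ → F (suc (proj₁ s) ∷ γ)))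
      ≡⟨ ∑-cong-All (splits-sum b) (λ {s} e → at (proj₁ s) (proj₂ s) e) ⟩
    ∑ (splits b) (λ s → ∑ (compositions (proj₂ s)) (λ a → G (suc (proj₁ s) ∷ a)))
      ≡⟨ ∑-compositions-suc b G ⟨
    ∑ (compositions (suc b)) G ∎
    where
    F G : List ℕ → ℚ
    F γ = ⟦ interval γ (suc b ∷ β) ⟧ *ℚ Ψ (takeUpTo (suc b) γ)
    G a = ⟦ evensThenOdds a ⟧ *ℚ ∑ (compositions m) (λ c → ⟦ interval c β ⟧ *ℚ Ψ (a , c))

    too-long : ∀ i j → i + j ≡ b + m → b < i → ∑ (compositions j) (λ γ → F (suc i ∷ γ)) ≡ 0ℚ
    too-long i j e b<i with ℕₚ.m≤n⇒∃[o]m+o≡n b<i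
    ... | k , refl = trans (∑-cong-All (compositions-⊨ j) (λ {γ} pγ → vanish β refl γ (proj₁ pγ))) (∑-zero (compositions j) (λ _ → refl))
      where
      -- For empty β the degree leaves no room for a first part this long; otherwise β cuts inside
      -- it.
      vanish : ∀ β′ → β′ ≡ β → ∀ γ → IsComposition γ → F (suc (suc b + k) ∷ γ) ≡ 0ℚ
      vanish []      refl γ pγ = ⊥-elim (ℕₚ.m+1+n≢m b (trans (trans (ℕₚ.+-suc b (k + j)) (cong suc (sym (ℕₚ.+-assoc b k j)))) (trans e (ℕₚ.+-identityʳ b))))
      vanish (c ∷ β′) refl γ pγ = trans (cong (λ x → ⟦ x ⟧ *ℚ Ψ (takeUpTo (suc b) (suc (suc b + k) ∷ γ)))
        (trans (cong (λ x → interval (suc x ∷ γ) (suc b ∷ β)) (sym (ℕₚ.+-suc b k))) (interval-gt (suc b) k {γ} {c} {β′} pγ)))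
        (ℚₚ.*-zeroˡ (Ψ (takeUpTo (suc b) (suc (suc b + k) ∷ γ))))

    at : ∀ i j → i + j ≡ b → ∑ (compositions (j + m)) (λ γ → F (suc i ∷ γ)) ≡ ∑ (compositions j) (λ a → G (suc i ∷ a))
    at i zero    e = begin
      ∑ (compositions m) (λ γ → F (suc i ∷ γ))
        ≡⟨ ∑-cong-All (compositions-⊨ m) (λ {γ} (pγ , sγ) → last-part γ pγ sγ (trans (sym (ℕₚ.+-identityʳ i)) e)) ⟩
      ∑ (compositions m) (λ c → ⟦ interval c β ⟧ *ℚ Ψ (suc i ∷ [] , c))
        ≡⟨ ℚₚ.*-identityˡ (∑ (compositions m) (λ c → ⟦ interval c β ⟧ *ℚ Ψ (suc i ∷ [] , c))) ⟨
      G (suc i ∷ [])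
        ≡⟨ ∑-[-] _ _ ⟨
      ∑ (compositions 0) (λ a → G (suc i ∷ a)) ∎
      where
      last-part : ∀ γ → IsComposition γ → sum γ ≡ m → i ≡ b → F (suc i ∷ γ) ≡ ⟦ interval γ β ⟧ *ℚ Ψ (suc i ∷ [] , γ)
      last-part γ pγ sγ refl = cong₂ (λ x t → ⟦ x ⟧ *ℚ Ψ t) (interval-eq (suc i) pγ pβ sγ)
        (trans (takeUpTo-∷ i (suc i) γ) (cong (λ t → suc i ∷ proj₁ (takeUpTo t γ) , proj₂ (takeUpTo t γ)) (ℕₚ.n∸n≡0 i)))
    at i (suc j) e = begin
      ∑ (compositions (suc j + m)) (λ γ → F (suc i ∷ γ))
        ≡⟨ ∑-cong-All (compositions-⊨ (suc j + m)) (λ {γ} (pγ , sγ) → first-part γ pγ sγ (sym e)) ⟩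
      ∑ (compositions (suc j + m)) (λ γ → ⟦ interval γ (suc j ∷ β) ⟧ *ℚ Ψ′ (takeUpTo (suc j) γ))
        ≡⟨ rec (ℕₚ.≤-trans (ℕₚ.m≤n+m (suc j) i) (ℕₚ.≤-reflexive e)) Ψ′ ⟩
      ∑ (compositions (suc j)) (λ a → ⟦ evensThenOdds a ⟧ *ℚ ∑ (compositions m) (λ c → ⟦ interval c β ⟧ *ℚ Ψ′ (a , c)))
        ≡⟨ ∑-cong (compositions (suc j)) (λ a → trans (cong (⟦ evensThenOdds a ⟧ *ℚ_) (trans (∑-cong (compositions m) (λ c →
             solve 3 (λ x y z → x :* (y :* z) := y :* (x :* z)) refl ⟦ interval c β ⟧ ⟦ noOtE (suc i) a ⟧ (Ψ (suc i ∷ a , c))))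
             (∑-*ˡ (compositions m) ⟦ noOtE (suc i) a ⟧ _)))
             (trans (solve 3 (λ x y z → x :* (y :* z) := (y :* x) :* z) refl ⟦ evensThenOdds a ⟧ ⟦ noOtE (suc i) a ⟧ (∑ (compositions m) (λ c → ⟦ interval c β ⟧ *ℚ Ψ (suc i ∷ a , c))))
               (cong (_*ℚ ∑ (compositions m) (λ c → ⟦ interval c β ⟧ *ℚ Ψ (suc i ∷ a , c))) (sym (⟦∧⟧ (noOtE (suc i) a) (evensThenOdds a)))))) ⟩
      ∑ (compositions (suc j)) (λ a → G (suc i ∷ a)) ∎
      where
      Ψ′ : List ℕ × List ℕ → ℚ
      Ψ′ t = ⟦ noOtE (suc i) (proj₁ t) ⟧ *ℚ Ψ (suc i ∷ proj₁ t , proj₂ t)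
      first-part : ∀ γ → IsComposition γ → sum γ ≡ suc j + m → b ≡ i + suc j →
        F (suc i ∷ γ) ≡ ⟦ interval γ (suc j ∷ β) ⟧ *ℚ Ψ′ (takeUpTo (suc j) γ)
      first-part (y ∷ γ) pγ sγ refl = begin
        F (suc i ∷ y ∷ γ)
          ≡⟨ cong₂ (λ x t → ⟦ x ⟧ *ℚ Ψ t) (interval-lt (suc i) j {y} {γ} pβ)
               (trans (takeUpTo-∷ (i + suc j) (suc i) (y ∷ γ)) (cong (λ t → suc i ∷ proj₁ (takeUpTo t (y ∷ γ)) , proj₂ (takeUpTo t (y ∷ γ))) (ℕₚ.m+n∸m≡n i (suc j)))) ⟩
        ⟦ noOtE (suc i) (y ∷ γ) ∧ interval (y ∷ γ) (suc j ∷ β) ⟧ *ℚ Ψ″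
          ≡⟨ trans (cong (_*ℚ Ψ″) (⟦∧⟧ (noOtE (suc i) (y ∷ γ)) (interval (y ∷ γ) (suc j ∷ β))))
               (solve 3 (λ x y z → (x :* y) :* z := y :* (x :* z)) refl ⟦ noOtE (suc i) (y ∷ γ) ⟧ ⟦ interval (y ∷ γ) (suc j ∷ β) ⟧ Ψ″) ⟩
        ⟦ interval (y ∷ γ) (suc j ∷ β) ⟧ *ℚ (⟦ noOtE (suc i) (y ∷ γ) ⟧ *ℚ Ψ″)
          ≡⟨ cong (λ x → ⟦ interval (y ∷ γ) (suc j ∷ β) ⟧ *ℚ (⟦ x ⟧ *ℚ Ψ″)) (cong (λ t → noOtE (suc i) (proj₁ t)) (sym (takeUpTo-∷ j y γ))) ⟩
        ⟦ interval (y ∷ γ) (suc j ∷ β) ⟧ *ℚ Ψ′ (takeUpTo (suc j) (y ∷ γ)) ∎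
        where Ψ″ = Ψ (suc i ∷ proj₁ (takeUpTo (suc j) (y ∷ γ)) , proj₂ (takeUpTo (suc j) (y ∷ γ)))

-- Expansion of h_β in the p_γ

p*-cong : ∀ a {f g} → f ≐ g → p* a f ≐ p* a g
p*-cong []      e δ = e δ
p*-cong (x ∷ a) e δ = cong (inv x *ℚ_) (∑-cong (lower x δ) (p*-cong a e))

p*-∑ : ∀ a {C : Set} (cs : List C) (k : C → ℚ) (g : C → List ℕ → ℚ) δ →
  p* a (λ ε → ∑ cs (λ c → k c *ℚ g c ε)) δ ≡ ∑ cs (λ c → k c *ℚ p* a (g c) δ)
p*-∑ []      cs k g δ = refl
p*-∑ (x ∷ a) cs k g δ = begin
  inv x *ℚ ∑ (lower x δ) (p* a (λ ε → ∑ cs (λ c → k c *ℚ g c ε)))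
    ≡⟨ cong (inv x *ℚ_) (trans (∑-cong (lower x δ) (p*-∑ a cs k g)) (∑-swap (lower x δ) cs _)) ⟩
  inv x *ℚ ∑ cs (λ c → ∑ (lower x δ) (λ ε → k c *ℚ p* a (g c) ε))
    ≡⟨ ∑-*ˡ cs (inv x) _ ⟨
  ∑ cs (λ c → inv x *ℚ ∑ (lower x δ) (λ ε → k c *ℚ p* a (g c) ε))
    ≡⟨ ∑-cong cs (λ c → trans (cong (inv x *ℚ_) (∑-*ˡ (lower x δ) (k c) _))
         (solve 3 (λ x y z → x :* (y :* z) := y :* (x :* z)) refl (inv x) (k c) (∑ (lower x δ) (p* a (g c))))) ⟩
  ∑ cs (λ c → k c *ℚ p* (x ∷ a) (g c) δ) ∎

p*-pProd : ∀ {a} → IsComposition a → ∀ c δ → p* a (val (pProd c)) δ ≡ val (pProd (a ++ c)) δ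
p*-pProd []                              c δ = refl
p*-pProd (_∷_ {suc k} {a} (s≤s z≤n) pa)  c δ = trans (cong (inv (suc k) *ℚ_) (∑-cong (lower (suc k) δ) (p*-pProd pa c)))
  (sym (val-p* k (pProd-positive (a ++ c)) δ))

-- Induction on β: `h*-powerSums` expands the first block with the product for the remaining blocks
-- as its factor, and `interval-split` reassembles the pairs `(a , c)` into γ = `a ++ c`.
val-hProd : ∀ {β} → IsComposition β → ∀ δ →
  val (hProd β) δ ≡ ∑ (compositions (sum β)) (λ γ → ⟦ interval γ β ⟧ *ℚ (coeffC γ β *ℚ val (pProd γ) δ))
val-hProd []                              δ = sym (trans (∑-[-] _ _)
  (solve 1 (λ x → con 1ℚ :* (con 1ℚ :* x) := x) refl (val oneL δ)))
val-hProd (_∷_ {suc b} {β} (s≤s z≤n) pβ)  δ = begin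
  val (mulL (hL (suc b)) (hProd β)) δ
    ≡⟨ val-h* (suc b) (hProd-positive β) δ ⟩
  h* (val (hProd β)) (suc b) δ
    ≡⟨ h*-powerSums (val (hProd β)) (suc b) δ ⟩
  ∑ (compositions (suc b)) (λ a → (⟦ evensThenOdds a ⟧ *ℚ blockCoeff a) *ℚ p* a (val (hProd β)) δ)
    ≡⟨ ∑-cong-All (compositions-⊨ (suc b)) (λ {a} (pa , _) → block a pa) ⟩
  ∑ (compositions (suc b)) (λ a → ⟦ evensThenOdds a ⟧ *ℚ ∑ (compositions (sum β)) (λ c → ⟦ interval c β ⟧ *ℚ Ψ (a , c)))
    ≡⟨ interval-split pβ b Ψ ⟨
  ∑ (compositions (suc b + sum β)) (λ γ → ⟦ interval γ (suc b ∷ β) ⟧ *ℚ Ψ (takeUpTo (suc b) γ))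
    -- The coefficient of γ unfolds by definition into first block times rest; only the
    -- concatenation has to be rewritten.
    ≡⟨ ∑-cong (compositions (suc b + sum β)) (λ γ → cong (λ x → ⟦ interval γ (suc b ∷ β) ⟧ *ℚ (coeffC γ (suc b ∷ β) *ℚ val (pProd x) δ)) (takeUpTo-++ (suc b) γ)) ⟩
  ∑ (compositions (suc b + sum β)) (λ γ → ⟦ interval γ (suc b ∷ β) ⟧ *ℚ (coeffC γ (suc b ∷ β) *ℚ val (pProd γ) δ)) ∎
  where
  Ψ : List ℕ × List ℕ → ℚ
  Ψ t = (blockCoeff (proj₁ t) *ℚ coeffC (proj₂ t) β) *ℚ val (pProd (proj₁ t ++ proj₂ t)) δ
  block : ∀ a → IsComposition a → (⟦ evensThenOdds a ⟧ *ℚ blockCoeff a) *ℚ p* a (val (hProd β)) δ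
    ≡ ⟦ evensThenOdds a ⟧ *ℚ ∑ (compositions (sum β)) (λ c → ⟦ interval c β ⟧ *ℚ Ψ (a , c))
  block a pa = trans (ℚₚ.*-assoc ⟦ evensThenOdds a ⟧ (blockCoeff a) (p* a (val (hProd β)) δ)) (cong (⟦ evensThenOdds a ⟧ *ℚ_) (begin
    blockCoeff a *ℚ p* a (val (hProd β)) δ
      ≡⟨ cong (blockCoeff a *ℚ_) (trans (p*-cong a (λ ε → trans (val-hProd pβ ε) (∑-cong (compositions (sum β)) (λ c →
           sym (ℚₚ.*-assoc ⟦ interval c β ⟧ (coeffC c β) (val (pProd c) ε))))) δ)
           (p*-∑ a (compositions (sum β)) (λ c → ⟦ interval c β ⟧ *ℚ coeffC c β) (λ c → val (pProd c)) δ)) ⟩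
    blockCoeff a *ℚ ∑ (compositions (sum β)) (λ c → (⟦ interval c β ⟧ *ℚ coeffC c β) *ℚ p* a (val (pProd c)) δ)
      ≡⟨ ∑-*ˡ (compositions (sum β)) (blockCoeff a) _ ⟨
    ∑ (compositions (sum β)) (λ c → blockCoeff a *ℚ ((⟦ interval c β ⟧ *ℚ coeffC c β) *ℚ p* a (val (pProd c)) δ))
      ≡⟨ ∑-cong (compositions (sum β)) (λ c → trans (cong (λ z → blockCoeff a *ℚ ((⟦ interval c β ⟧ *ℚ coeffC c β) *ℚ z)) (p*-pProd pa c δ))
           (solve 4 (λ k i c v → k :* ((i :* c) :* v) := i :* ((k :* c) :* v)) refl (blockCoeff a) ⟦ interval c β ⟧ (coeffC c β) (val (pProd (a ++ c)) δ))) ⟩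
    ∑ (compositions (sum β)) (λ c → ⟦ interval c β ⟧ *ℚ Ψ (a , c)) ∎))

-- Shuffle coefficients and pairing with a dual family

∑-filterᵇ : ∀ {A : Set} (p : A → Bool) xs F → ∑ (filterᵇ p xs) F ≡ ∑ xs (λ x → ⟦ p x ⟧ *ℚ F x)
∑-filterᵇ p []       F = trans (∑-[] F) (sym (∑-[] _))
∑-filterᵇ p (x ∷ xs) F with p x in e
... | true  = trans (∑-∷ x _ F) (trans (cong₂ _+ℚ_ (trans (sym (ℚₚ.*-identityˡ (F x))) (cong (λ b → ⟦ b ⟧ *ℚ F x) (sym e))) (∑-filterᵇ p xs F)) (sym (∑-∷ x xs _)))
... | false = trans (trans (∑-filterᵇ p xs F) (sym (ℚₚ.+-identityˡ r)))
  (trans (cong (_+ℚ r) (trans (sym (ℚₚ.*-zeroˡ (F x))) (cong (λ b → ⟦ b ⟧ *ℚ F x) (sym e)))) (sym (∑-∷ x xs _)))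
  where r = ∑ xs (λ x → ⟦ p x ⟧ *ℚ F x)

coeff-S : ∀ γ {β} → IsComposition β → coeff (S γ) β ≡ ⟦ sum β ≡ᵇ sum γ ⟧ *ℚ (⟦ interval γ β ⟧ *ℚ coeffC γ β)
coeff-S γ {β} pβ = begin
  coeff (S γ) β
    ≡⟨ trans (coeff-∑ (S γ) β) (trans (∑-map _ (filterᵇ (interval γ) (compositions (sum γ))) _) (∑-filterᵇ (interval γ) (compositions (sum γ)) _)) ⟩
  ∑ (compositions (sum γ)) (λ c → ⟦ interval γ c ⟧ *ℚ (coeffC γ c *ℚ ⟦ c == β ⟧))
    ≡⟨ ∑-cong (compositions (sum γ)) (λ c → solve 3 (λ i k e → i :* (k :* e) := e :* (i :* k)) refl ⟦ interval γ c ⟧ (coeffC γ c) ⟦ c == β ⟧) ⟩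
  ∑ (compositions (sum γ)) (λ c → ⟦ c == β ⟧ *ℚ (⟦ interval γ c ⟧ *ℚ coeffC γ c))
    ≡⟨ ∑-compositions-pick (sum γ) pβ (λ c → ⟦ interval γ c ⟧ *ℚ coeffC γ c) ⟩
  ⟦ sum β ≡ᵇ sum γ ⟧ *ℚ (⟦ interval γ β ⟧ *ℚ coeffC γ β) ∎

∑-degree-pick : ∀ k N c → k ≤ N → ∑ (splits N) (λ s → ⟦ k ≡ᵇ proj₁ s ⟧ *ℚ c) ≡ c
∑-degree-pick k N c h = trans (∑-sub-pick k N (λ _ → c)) (const k N h)
  where
  const : ∀ k N → k ≤ N → ∑ (sub k N) (λ _ → c) ≡ c
  const zero    N       _       = ∑-[-] _ _
  const (suc k) (suc N) (s≤s h) = const k N h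

-- A combination of H's may involve several degrees, so the range of γ must not depend on β. The
-- added terms vanish because S_γ is homogeneous.
val-hProd-S : ∀ {β} → IsComposition β → ∀ N → sum β ≤ N → ∀ δ →
  val (hProd β) δ ≡ ∑ (splits N) (λ s → ∑ (compositions (proj₁ s)) (λ γ → coeff (S γ) β *ℚ val (pProd γ) δ))
val-hProd-S {β} pβ N h δ = begin
  val (hProd β) δ
    ≡⟨ val-hProd pβ δ ⟩
  total (sum β)
    ≡⟨ ∑-degree-pick (sum β) N (total (sum β)) h ⟨
  ∑ (splits N) (λ s → ⟦ sum β ≡ᵇ proj₁ s ⟧ *ℚ total (sum β))
    ≡⟨ ∑-cong (splits N) (λ s → in-degree (proj₁ s)) ⟩
  ∑ (splits N) (λ s → ⟦ sum β ≡ᵇ proj₁ s ⟧ *ℚ total (proj₁ s))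
    ≡⟨ ∑-cong (splits N) (λ s → trans (sym (∑-*ˡ (compositions (proj₁ s)) ⟦ sum β ≡ᵇ proj₁ s ⟧ _))
         (∑-cong-All (compositions-⊨ (proj₁ s)) (λ {γ} (_ , e) → term (proj₁ s) γ e))) ⟩
  ∑ (splits N) (λ s → ∑ (compositions (proj₁ s)) (λ γ → coeff (S γ) β *ℚ val (pProd γ) δ)) ∎
  where
  total : ℕ → ℚ
  total n = ∑ (compositions n) (λ γ → ⟦ interval γ β ⟧ *ℚ (coeffC γ β *ℚ val (pProd γ) δ))
  in-degree : ∀ n → ⟦ sum β ≡ᵇ n ⟧ *ℚ total (sum β) ≡ ⟦ sum β ≡ᵇ n ⟧ *ℚ total n
  in-degree n with sum β ≡ᵇ n in e
  ... | true  = cong (λ k → 1ℚ *ℚ total k) (≡ᵇ-true {sum β} {n} e)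
  ... | false = trans (ℚₚ.*-zeroˡ (total (sum β))) (sym (ℚₚ.*-zeroˡ (total n)))
  term : ∀ n γ → sum γ ≡ n → ⟦ sum β ≡ᵇ n ⟧ *ℚ (⟦ interval γ β ⟧ *ℚ (coeffC γ β *ℚ val (pProd γ) δ)) ≡ coeff (S γ) β *ℚ val (pProd γ) δ
  term _ γ refl = trans (solve 4 (λ d i c v → d :* (i :* (c :* v)) := (d :* (i :* c)) :* v) refl ⟦ sum β ≡ᵇ sum γ ⟧ ⟦ interval γ β ⟧ (coeffC γ β) (val (pProd γ) δ))
    (cong (_*ℚ val (pProd γ) δ) (sym (coeff-S γ pβ)))

pair-∑ : ∀ X f → pair X f ≡ ∑ X (λ t → coeff f (proj₂ t) *ℚ proj₁ t)
pair-∑ []      f = sym (∑-[] _)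
pair-∑ (t ∷ X) f = trans (cong (coeff f (proj₂ t) *ℚ proj₁ t +ℚ_) (pair-∑ X f)) (sym (∑-∷ t X _))

val-π : ∀ X δ → val (π X) δ ≡ ∑ X (λ t → proj₁ t *ℚ val (hProd (proj₂ t)) δ)
val-π X δ = begin
  val (π X) δ
    ≡⟨ trans (val-∑ (π X) δ) (∑-concatMap _ X _) ⟩
  ∑ X (λ t → ∑ (scaleL (proj₁ t) (hProd (proj₂ t))) (λ s → proj₁ s *ℚ mono (proj₂ s) δ))
    ≡⟨ ∑-cong X (λ t → trans (∑-map _ (hProd (proj₂ t)) _) (trans
         (∑-cong (hProd (proj₂ t)) (λ s → ℚₚ.*-assoc (proj₁ t) (proj₁ s) (mono (proj₂ s) δ)))
         (trans (∑-*ˡ (hProd (proj₂ t)) (proj₁ t) _) (cong (proj₁ t *ℚ_) (sym (val-∑ (hProd (proj₂ t)) δ)))))) ⟩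
  ∑ X (λ t → proj₁ t *ℚ val (hProd (proj₂ t)) δ) ∎

==-comm : ∀ xs ys → (xs == ys) ≡ (ys == xs)
==-comm xs ys with Listₚ.≡-dec ℕ._≟_ xs ys
... | yes refl = sym (==-refl xs)
... | no  n    = sym (==-≢ (λ e → n (sym e)))

degree-bound : ∀ (X : LinComb) → ∃ λ N → All (λ t → sum (proj₂ t) ≤ N) X
degree-bound []      = 0 , []
degree-bound (t ∷ X) = let N , b = degree-bound X in
  sum (proj₂ t) + N , ℕₚ.m≤m+n _ N ∷ All.map (λ h → ℕₚ.≤-trans h (ℕₚ.m≤n+m N _)) b

val-π-dual : ∀ {α X} → IsComposition α → IsDualS α X → ∀ δ → val (π X) δ ≡ val (pProd α) δ
val-π-dual {α} {X} pα (pX , dual) δ = begin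
  val (π X) δ
    ≡⟨ val-π X δ ⟩
  ∑ X (λ t → proj₁ t *ℚ val (hProd (proj₂ t)) δ)
    ≡⟨ ∑-cong-All (All.zip (pX , proj₂ (degree-bound X))) (λ {t} (pt , h) →
         cong (proj₁ t *ℚ_) (val-hProd-S pt N (ℕₚ.≤-trans h (ℕₚ.m≤n+m _ (sum α))) δ)) ⟩
  ∑ X (λ t → proj₁ t *ℚ ∑ (splits N) (λ s → ∑ (compositions (proj₁ s)) (λ γ → coeff (S γ) (proj₂ t) *ℚ val (pProd γ) δ)))
    ≡⟨ ∑-cong X (λ t → trans (sym (∑-*ˡ (splits N) (proj₁ t) _)) (∑-cong (splits N) (λ s → sym (∑-*ˡ (compositions (proj₁ s)) (proj₁ t) _)))) ⟩
  ∑ X (λ t → ∑ (splits N) (λ s → ∑ (compositions (proj₁ s)) (λ γ → proj₁ t *ℚ (coeff (S γ) (proj₂ t) *ℚ val (pProd γ) δ))))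
    ≡⟨ trans (∑-swap X (splits N) _) (∑-cong (splits N) (λ s → ∑-swap X (compositions (proj₁ s)) _)) ⟩
  ∑ (splits N) (λ s → ∑ (compositions (proj₁ s)) (λ γ → ∑ X (λ t → proj₁ t *ℚ (coeff (S γ) (proj₂ t) *ℚ val (pProd γ) δ))))
    ≡⟨ ∑-cong (splits N) (λ s → ∑-cong-All (compositions-⊨ (proj₁ s)) (λ {γ} (pγ , _) → pairing γ pγ)) ⟩
  ∑ (splits N) (λ s → ∑ (compositions (proj₁ s)) (λ γ → ⟦ γ == α ⟧ *ℚ val (pProd γ) δ))
    ≡⟨ ∑-cong (splits N) (λ s → ∑-compositions-pick (proj₁ s) pα (λ γ → val (pProd γ) δ)) ⟩
  ∑ (splits N) (λ s → ⟦ sum α ≡ᵇ proj₁ s ⟧ *ℚ val (pProd α) δ)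
    ≡⟨ ∑-degree-pick (sum α) N (val (pProd α) δ) (ℕₚ.m≤m+n (sum α) _) ⟩
  val (pProd α) δ ∎
  where
  -- `sum α` is included so that the degree of α lies in the range without inspecting `X`.
  N = sum α + proj₁ (degree-bound X)
  pairing : ∀ γ → IsComposition γ → ∑ X (λ t → proj₁ t *ℚ (coeff (S γ) (proj₂ t) *ℚ val (pProd γ) δ)) ≡ ⟦ γ == α ⟧ *ℚ val (pProd γ) δ
  pairing γ pγ = begin
    ∑ X (λ t → proj₁ t *ℚ (coeff (S γ) (proj₂ t) *ℚ val (pProd γ) δ))
      ≡⟨ ∑-cong X (λ t → solve 3 (λ x y z → x :* (y :* z) := (y :* x) :* z) refl (proj₁ t) (coeff (S γ) (proj₂ t)) (val (pProd γ) δ)) ⟩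
    ∑ X (λ t → (coeff (S γ) (proj₂ t) *ℚ proj₁ t) *ℚ val (pProd γ) δ)
      ≡⟨ ∑-*ʳ X (val (pProd γ) δ) _ ⟩
    ∑ X (λ t → coeff (S γ) (proj₂ t) *ℚ proj₁ t) *ℚ val (pProd γ) δ
      ≡⟨ cong (_*ℚ val (pProd γ) δ) (trans (sym (pair-∑ X (S γ))) (trans (dual γ pγ) (cong ⟦_⟧ (==-comm α γ)))) ⟩
    ⟦ γ == α ⟧ *ℚ val (pProd γ) δ ∎

π-positive : ∀ X → Positive (π X)
π-positive X = Allₚ.concat⁺ (Allₚ.map⁺ (All.universal (λ t → Allₚ.map⁺ (hProd-positive (proj₂ t))) X))

π-dual : ∀ {α X} → IsComposition α → IsDualS α X → π X ≈L pProd α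
π-dual {α} {X} pα d γ with All.all? (1 ℕ.≤?_) γ
... | yes pγ = subst (λ γ → coeff (π X) γ ≡ coeff (pProd α) γ) (nonzeros-id pγ) (val-π-dual pα d γ)
... | no  nγ = trans (coeff-nonpositive (π-positive X) nγ) (sym (coeff-nonpositive (pProd-positive α) nγ))

-- Existence of the dual basis

-- Triangularity of S_γ: going down from γ only merges parts. The first parts are compared, and the
-- three cases are those of `interval-eq`, `interval-lt` and `interval-gt`.
interval-longer : ∀ {γ β} → IsComposition γ → IsComposition β → sum γ ≡ sum β → interval γ β ≡ true → β ≡ γ ⊎ length β < length γ
interval-longer {[]}    {[]}    pγ pβ e i = inj₁ refl
interval-longer {[]}    {_ ∷ _} pγ pβ e i = ⊥-elim (sum-positive pβ (sym e))
interval-longer {_ ∷ _} {[]}    pγ pβ e i = ⊥-elim (sum-positive pγ e)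
interval-longer {x ∷ γ} {b ∷ β} pγ pβ e i with ℕ.compare x b
interval-longer {x ∷ γ} {x ∷ β} (_ ∷ pγ) (_ ∷ pβ) e i | ℕ.equal x
  with interval-longer pγ pβ e′ (trans (sym (interval-eq x pγ pβ e′)) i)
  where e′ = ℕₚ.+-cancelˡ-≡ x (sum γ) (sum β) e
... | inj₁ refl = inj₁ refl
... | inj₂ l    = inj₂ (s≤s l)
interval-longer {x ∷ []} {_ ∷ β} pγ pβ e i | ℕ.less x k =
  ⊥-elim (ℕₚ.<-irrefl e (s≤s (ℕₚ.≤-trans (ℕₚ.≤-reflexive (ℕₚ.+-identityʳ x)) (ℕₚ.≤-trans (ℕₚ.m≤m+n x k) (ℕₚ.m≤m+n (x + k) (sum β))))))
interval-longer {x ∷ y ∷ γ} {_ ∷ β} (_ ∷ pγ) (_ ∷ pβ) e i | ℕ.less x k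
  with interval-longer pγ (s≤s z≤n ∷ pβ) e′ i′
  where
  e′ : sum (y ∷ γ) ≡ sum (suc k ∷ β)
  e′ = ℕₚ.+-cancelˡ-≡ x _ _ (trans e (trans (cong (λ z → z + sum β) (sym (ℕₚ.+-suc x k))) (ℕₚ.+-assoc x (suc k) (sum β))))
  i′ : interval (y ∷ γ) (suc k ∷ β) ≡ true
  i′ = Boolₚ.∧-conicalʳ (noOtE x (y ∷ γ)) _ (trans (sym (interval-lt x k {y} {γ} pβ)) (trans (cong (λ z → interval (x ∷ y ∷ γ) (z ∷ β)) (ℕₚ.+-suc x k)) i))
... | inj₁ r = inj₂ (ℕₚ.≤-reflexive (cong (λ l → suc (length l)) r))
... | inj₂ l = inj₂ (ℕₚ.m≤n⇒m≤1+n l)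
interval-longer {_ ∷ γ} {b ∷ []} pγ pβ e i | ℕ.greater b k =
  ⊥-elim (ℕₚ.<-irrefl (sym e) (s≤s (ℕₚ.≤-trans (ℕₚ.≤-reflexive (ℕₚ.+-identityʳ b)) (ℕₚ.≤-trans (ℕₚ.m≤m+n b k) (ℕₚ.m≤m+n (b + k) (sum γ))))))
interval-longer {_ ∷ γ} {b ∷ c ∷ β} (_ ∷ pγ) pβ e i | ℕ.greater b k
  with trans (sym (interval-gt b k {γ} {c} {β} pγ)) (trans (cong (λ z → interval (z ∷ γ) (b ∷ c ∷ β)) (ℕₚ.+-suc b k)) i)
... | ()

interval-refl : ∀ {γ} → IsComposition γ → interval γ γ ≡ true
interval-refl []               = refl
interval-refl (_∷_ {x} px pγ)  = trans (interval-eq x pγ pγ refl) (interval-refl pγ)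

coeffC-refl : ∀ {γ} → IsComposition γ → coeffC γ γ ≡ 1ℚ
coeffC-refl []                                  = refl
coeffC-refl (_∷_ {suc k} {γ} (s≤s z≤n) pγ) = begin
  coeffC (suc k ∷ γ) (suc k ∷ γ)                    ≡⟨ cong (λ t → blockCoeff (proj₁ t) *ℚ coeffC (proj₂ t) γ) first-block ⟩
  blockCoeff (suc k ∷ []) *ℚ coeffC γ γ             ≡⟨ cong₂ _*ℚ_ (singleton (suc k)) (coeffC-refl pγ) ⟩
  1ℚ *ℚ 1ℚ                                          ≡⟨⟩
  1ℚ                                                ∎
  where
  first-block : takeUpTo (suc k) (suc k ∷ γ) ≡ (suc k ∷ [] , γ)
  first-block = trans (takeUpTo-∷ k (suc k) γ) (cong (λ t → suc k ∷ proj₁ (takeUpTo t γ) , proj₂ (takeUpTo t γ)) (ℕₚ.n∸n≡0 k))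
  singleton : ∀ x → blockCoeff (x ∷ []) ≡ 1ℚ
  singleton x with isOdd x
  ... | true  = refl
  ... | false = refl

coeff-S-refl : ∀ {γ} → IsComposition γ → coeff (S γ) γ ≡ 1ℚ
coeff-S-refl {γ} pγ = trans (coeff-S γ pγ) (cong₂ _*ℚ_ (cong ⟦_⟧ (≡ᵇ-refl (sum γ)))
  (cong₂ _*ℚ_ (cong ⟦_⟧ (interval-refl pγ)) (coeffC-refl pγ)))

length≤sum : ∀ {γ} → IsComposition γ → length γ ≤ sum γ
length≤sum []       = z≤n
length≤sum (p ∷ pγ) = ℕₚ.+-mono-≤ p (length≤sum pγ)

-- H_α = ∑_γ coeff (S γ) α S_γ*, where all terms other than γ = α have more parts than α; hence the fuel.
dualS : ℕ → Composition → LinComb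
dualS zero    α = []
dualS (suc k) α = (1ℚ , α) ∷ concatMap (λ γ → scaleL (-ℚ (⟦ not (γ == α) ⟧ *ℚ coeff (S γ) α)) (dualS k γ)) (compositions (sum α))

dualS-positive : ∀ k {α} → IsComposition α → Positive (dualS k α)
dualS-positive zero        pα = []
dualS-positive (suc k) {α} pα = pα ∷ Allₚ.concat⁺ (Allₚ.map⁺ (All.map (λ (pγ , _) → Allₚ.map⁺ (dualS-positive k pγ)) (compositions-⊨ (sum α))))

pair-scaleL : ∀ c X f → pair (scaleL c X) f ≡ c *ℚ pair X f
pair-scaleL c X f = begin
  pair (scaleL c X) f
    ≡⟨ trans (pair-∑ (scaleL c X) f) (∑-map _ X _) ⟩
  ∑ X (λ t → coeff f (proj₂ t) *ℚ (c *ℚ proj₁ t))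
    ≡⟨ ∑-cong X (λ t → solve 3 (λ x y z → x :* (y :* z) := y :* (x :* z)) refl (coeff f (proj₂ t)) c (proj₁ t)) ⟩
  ∑ X (λ t → c *ℚ (coeff f (proj₂ t) *ℚ proj₁ t))
    ≡⟨ trans (∑-*ˡ X c _) (cong (c *ℚ_) (sym (pair-∑ X f))) ⟩
  c *ℚ pair X f ∎

-- A composition has at most as many parts as its sum, so the bound cannot hold with fuel 0; each
-- recursive call keeps the sum and gains at least one part, which pays for the fuel spent.
pair-dualS : ∀ k {α} → IsComposition α → sum α < k + length α → ∀ ε → IsComposition ε → pair (dualS k α) (S ε) ≡ δ α ε
pair-dualS zero        pα h ε pε = ⊥-elim (ℕₚ.<-irrefl refl (ℕₚ.<-≤-trans h (length≤sum pα)))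
pair-dualS (suc k) {α} pα h ε pε = begin
  coeff (S ε) α *ℚ 1ℚ +ℚ pair (concatMap (λ γ → scaleL (c γ) (dualS k γ)) (compositions (sum α))) (S ε)
    ≡⟨ cong₂ _+ℚ_ (ℚₚ.*-identityʳ (coeff (S ε) α)) (trans (pair-∑ (concatMap (λ γ → scaleL (c γ) (dualS k γ)) (compositions (sum α))) (S ε))
         (trans (∑-concatMap _ (compositions (sum α)) _) (∑-cong (compositions (sum α)) (λ γ →
           trans (sym (pair-∑ (scaleL (c γ) (dualS k γ)) (S ε))) (pair-scaleL (c γ) (dualS k γ) (S ε)))))) ⟩
  coeff (S ε) α +ℚ ∑ (compositions (sum α)) (λ γ → c γ *ℚ pair (dualS k γ) (S ε))
    ≡⟨ cong (coeff (S ε) α +ℚ_) (∑-cong-All (compositions-⊨ (sum α)) (λ {γ} (pγ , e) → term γ pγ e)) ⟩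
  coeff (S ε) α +ℚ ∑ (compositions (sum α)) (λ γ → ⟦ γ == ε ⟧ *ℚ c γ)
    ≡⟨ cong (coeff (S ε) α +ℚ_) (∑-compositions-pick (sum α) pε c) ⟩
  coeff (S ε) α +ℚ ⟦ sum ε ≡ᵇ sum α ⟧ *ℚ c ε
    ≡⟨ cancel ⟩
  δ α ε ∎
  where
  c : Composition → ℚ
  c γ = -ℚ (⟦ not (γ == α) ⟧ *ℚ coeff (S γ) α)

  c-vanish : ∀ γ → γ ≡ α ⊎ interval γ α ≡ false → c γ ≡ 0ℚ
  c-vanish γ (inj₁ refl) = trans (cong (λ x → -ℚ (⟦ not x ⟧ *ℚ coeff (S γ) γ)) (==-refl γ)) (cong -ℚ_ (ℚₚ.*-zeroˡ (coeff (S γ) γ)))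
  c-vanish γ (inj₂ e)    = trans
    (cong (λ x → -ℚ (⟦ not (γ == α) ⟧ *ℚ x)) (trans (coeff-S γ pα) (cong (λ x → ⟦ sum α ≡ᵇ sum γ ⟧ *ℚ (⟦ x ⟧ *ℚ coeffC γ α)) e)))
    (solve 3 (λ n s k → :- (n :* (s :* (con 0ℚ :* k))) := con 0ℚ) refl ⟦ not (γ == α) ⟧ ⟦ sum α ≡ᵇ sum γ ⟧ (coeffC γ α))

  term : ∀ γ → IsComposition γ → sum γ ≡ sum α → c γ *ℚ pair (dualS k γ) (S ε) ≡ ⟦ γ == ε ⟧ *ℚ c γ
  term γ pγ e = by-cases (interval γ α) refl
    where
    both-zero : c γ ≡ 0ℚ → c γ *ℚ pair (dualS k γ) (S ε) ≡ ⟦ γ == ε ⟧ *ℚ c γ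
    both-zero z = trans (trans (cong (_*ℚ pair (dualS k γ) (S ε)) z) (ℚₚ.*-zeroˡ (pair (dualS k γ) (S ε))))
                        (sym (trans (cong (⟦ γ == ε ⟧ *ℚ_) z) (ℚₚ.*-zeroʳ ⟦ γ == ε ⟧)))
    by-length : α ≡ γ ⊎ length α < length γ → c γ *ℚ pair (dualS k γ) (S ε) ≡ ⟦ γ == ε ⟧ *ℚ c γ
    by-length (inj₁ r) = both-zero (c-vanish γ (inj₁ (sym r)))
    by-length (inj₂ l) = trans (cong (c γ *ℚ_) (pair-dualS k pγ h′ ε pε)) (ℚₚ.*-comm (c γ) ⟦ γ == ε ⟧)
      where
      h′ : sum γ < k + length γ
      h′ = ℕₚ.≤-trans (ℕₚ.≤-reflexive (cong suc e)) (ℕₚ.≤-trans h (ℕₚ.≤-trans (ℕₚ.≤-reflexive (sym (ℕₚ.+-suc k (length α)))) (ℕₚ.+-monoʳ-≤ k l)))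
    by-cases : ∀ b → interval γ α ≡ b → c γ *ℚ pair (dualS k γ) (S ε) ≡ ⟦ γ == ε ⟧ *ℚ c γ
    by-cases true  i = by-length (interval-longer pγ pα e i)
    by-cases false i = both-zero (c-vanish γ (inj₂ i))

  -- For ε ≠ α of equal degree `c ε` is the negative of the first term; in other degrees both terms
  -- are 0; for ε = α the correction is switched off and the diagonal entry 1 remains.
  cancel : coeff (S ε) α +ℚ ⟦ sum ε ≡ᵇ sum α ⟧ *ℚ c ε ≡ δ α ε
  cancel = by-equality (Listₚ.≡-dec ℕ._≟_ α ε)
    where
    by-degree : ∀ b → (sum ε ≡ᵇ sum α) ≡ b → coeff (S ε) α +ℚ ⟦ b ⟧ *ℚ (-ℚ (1ℚ *ℚ coeff (S ε) α)) ≡ 0ℚ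
    by-degree true  s = solve 1 (λ x → x :+ con 1ℚ :* (:- (con 1ℚ :* x)) := con 0ℚ) refl (coeff (S ε) α)
    by-degree false s = trans
      (cong (λ x → x +ℚ 0ℚ *ℚ (-ℚ (1ℚ *ℚ x))) (trans (coeff-S ε pα)
        (cong (λ x → ⟦ x ⟧ *ℚ (⟦ interval ε α ⟧ *ℚ coeffC ε α)) (trans (≡ᵇ-comm (sum α) (sum ε)) s))))
      (solve 1 (λ x → con 0ℚ :* x :+ con 0ℚ :* (:- (con 1ℚ :* (con 0ℚ :* x))) := con 0ℚ) refl (⟦ interval ε α ⟧ *ℚ coeffC ε α))
    by-equality : Dec (α ≡ ε) → coeff (S ε) α +ℚ ⟦ sum ε ≡ᵇ sum α ⟧ *ℚ c ε ≡ δ α ε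
    by-equality (yes refl) = begin
      coeff (S ε) ε +ℚ ⟦ sum ε ≡ᵇ sum ε ⟧ *ℚ c ε ≡⟨ cong₂ (λ x y → x +ℚ ⟦ sum ε ≡ᵇ sum ε ⟧ *ℚ y) (coeff-S-refl pε) (c-vanish ε (inj₁ refl)) ⟩
      1ℚ +ℚ ⟦ sum ε ≡ᵇ sum ε ⟧ *ℚ 0ℚ             ≡⟨ cong (1ℚ +ℚ_) (ℚₚ.*-zeroʳ ⟦ sum ε ≡ᵇ sum ε ⟧) ⟩
      1ℚ                                         ≡⟨ cong ⟦_⟧ (==-refl ε) ⟨
      δ ε ε                                      ∎
    by-equality (no n) = begin
      coeff (S ε) α +ℚ ⟦ sum ε ≡ᵇ sum α ⟧ *ℚ c ε
        ≡⟨ cong (λ x → coeff (S ε) α +ℚ ⟦ sum ε ≡ᵇ sum α ⟧ *ℚ (-ℚ (⟦ not x ⟧ *ℚ coeff (S ε) α))) (==-≢ {ε} {α} (λ e → n (sym e))) ⟩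
      coeff (S ε) α +ℚ ⟦ sum ε ≡ᵇ sum α ⟧ *ℚ (-ℚ (1ℚ *ℚ coeff (S ε) α))
        ≡⟨ by-degree (sum ε ≡ᵇ sum α) refl ⟩
      0ℚ
        ≡⟨ cong ⟦_⟧ (==-≢ n) ⟨
      δ α ε ∎

mainTheorem6 : (α : Composition) → IsComposition α →
    (Σ LinComb (λ X → IsDualS α X))
    × (∀ (X : LinComb) → IsDualS α X → π X ≈L pProd α)
mainTheorem6 α pα = (dualS k α , dualS-positive k pα , pair-dualS k pα (ℕₚ.m≤m+n k (length α))) , λ X → π-dual pα
  -- This much fuel meets the bound of `pair-dualS` whatever the number of parts.
  where k = suc (sum α)
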